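{- A lattice simplex $\Delta$ is thin if and only if the corresponding linear code $C_\Delta$ is thin, i.e. if and only if $C_\Delta$ contains no word all of whose $d+1$ entries are nonzero (where $d=\dim\Delta$).
   Context: Let $M\cong\mathbb{Z}^d$ be a lattice and $\Delta$ a $d$-dimensional lattice simplex in $M\otimes\mathbb{R}$ with vertices $v_0,\dots,v_d\in M$. Local $h^*$-polynomial: $l^*(\Delta,t)=\sum_{\emptyset\subseteq F\subseteq\Delta}(-1)^{\dim\Delta-\dim F}h^*(F,t)$ (sum over all faces, with $\dim\emptyset=-1$, $h^*(\emptyset,t)=1$); equivalently $l^*(\Delta,t)=\sum_{\lambda}t^{\lambda_{d+1}}$, the sum being over the points $\lambda\in M\oplus\mathbb{Z}$ in the open parallelepiped $\Pi_\Delta^\circ=\{\sum_{i=0}^d a_i(v_i,1):0<a_i<1\}$, where $\lambda_{d+1}$ is the last coordinate. $\Delta$ is called thin if $l^*(\Delta,t)=0$. Code of a simplex: $\mathbb{Z}_N=\mathbb{Z}/N\mathbb{Z}$, with elements identified with $0,\dots,N-1$. Let $\Lambda_\Delta=\{x\in(\mathbb{R}/\mathbb{Z})^{d+1}:\sum_i\{x_i\}(v_i,1)\in M\oplus\mathbb{Z}\}$, where $\{\cdot\}$ is the fractional part. $N_\Delta$ is the least common multiple of the denominators of all coordinates of elements of $\Lambda_\Delta$, and $C_\Delta=\{(N_\Delta\{x_0\},\dots,N_\Delta\{x_d\}):x\in\Lambda_\Delta\}\subseteq\mathbb{Z}_{N_\Delta}^{d+1}$, a $\mathbb{Z}_{N_\Delta}$-submodule.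 A linear code $C\subseteq\mathbb{Z}_N^n$ is extended if every word has coordinate sum $0\bmod N$ ($C_\Delta$ is extended), and an extended code is thin if it has no word with all $n$ entries nonzero. -}

module Defs where

open import Data.Nat as ℕ using (ℕ; zero; suc; NonZero)
import Data.Nat.Properties as ℕ
open import Data.Nat.Divisibility using (_∣_; ∣-trans; 1∣_; divides; 0∣⇒≡0; m∣m*n; n∣m*n)
open import Data.Nat.DivMod using (_mod_; _%_; m≡m%n+[m/n]*n; m%n<n)
open import Data.Nat.LCM using (lcm; m∣lcm[m,n]; n∣lcm[m,n]; lcm-least)
open import Data.Nat.Coprimality using (1-coprimeTo) renaming (sym to coprime-sym)
open import Data.Integer as ℤ using (ℤ; +_; -[1+_]; 0ℤ; -1ℤ)
import Data.Integer.Properties as ℤ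
import Data.Integer.DivMod as ℤ
open import Data.Rational using (ℚ; mkℚ; _+_; _*_; _-_; -_; _/_; _≤_; _<_; 0ℚ; 1ℚ; ↧ₙ_; ∣_∣; 1/_; *≤*; *<*; toℚᵘ; floor; nonNegative; ≢-nonZero)
import Data.Rational as ℚ
import Data.Rational.Properties as ℚ
open import Data.Rational.Unnormalised as ℚᵘ using (mkℚᵘ; *≡*)
import Data.Rational.Unnormalised.Properties as ℚᵘ
open import Data.Rational.Solver using (module +-*-Solver)
open import Data.Fin as Fin using (Fin; zero; suc; toℕ; punchIn)
import Data.Fin.Properties as Fin
open import Data.Fin.Subset using (Subset; inside; outside) renaming (∣_∣ to size; _∉_ to _∉ₛ_)
open import Data.Fin.Subset.Properties using (_∈?_)
open import Data.Vec as Vec using (Vec; []; _∷_; lookup)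
import Data.Vec.Properties as Vec
open import Data.Vec.Functional as VF using (insertAt)
import Data.Vec.Functional.Properties as VF
open import Data.List as List using (List; []; _∷_; _++_; map; filter; foldr; length; cartesianProductWith; cartesianProduct; concatMap; upTo)
open import Data.List.Membership.Propositional using (_∈_; lose; find)
import Data.List.Membership.Propositional.Properties as ∈
open import Data.List.Relation.Unary.Any using (here; there)
open import Data.List.Relation.Unary.All using ([])
import Data.List.Relation.Unary.AllPairs as AllPairs
open import Data.List.Relation.Unary.Unique.Propositional using (Unique)
import Data.List.Relation.Unary.Unique.Propositional.Properties as Unique
open import Algebra.Properties.CommutativeMonoid.Sum ℚ.+-0-commutativeMonoid using (sum; sum-syntax; sum-cong-≗; sum-remove; sum-replicate-zero; ∑-distrib-+)
import Algebra
open import Algebra.Properties.CommutativeMonoid.Sum ℕ.+-0-commutativeMonoid using () renaming (sum to sumℕ)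
open import Algebra.Properties.Group ℚ.+-0-group using (x∙y⁻¹≈ε⇒x≈y)
open import Algebra.Properties.Semiring.Sum (Algebra.CommutativeRing.semiring ℚ.+-*-commutativeRing) using (*-distribˡ-sum)
open import Data.Product using (∃; ∃-syntax; _×_; _,_; proj₁; proj₂)
open import Function using (_∘_; _⇔_; mk⇔)
open import Level using (0ℓ)
open import Relation.Nullary using (¬_; Dec; yes; no; ¬?; _→-dec_; _×-dec_)
import Relation.Nullary.Decidable as Dec
open import Relation.Unary using (Pred)
open import Relation.Binary.PropositionalEquality using (_≡_; _≢_; _≗_; refl; sym; trans; cong; cong₂; subst; module ≡-Reasoning)

-- The lattice is M = ℤ^d.  The coefficients of a combination of the vectors
-- (vᵢ , 1) that is a lattice point are automatically rational when the vᵢ are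
-- affinely independent lattice points, so rational coefficients are used
-- throughout.

Lattice : ℕ → Set
Lattice d = Vec ℤ d

toℚ : ℤ → ℚ
toℚ z = z / 1

-- Combination v a (m , h) says  ∑ᵢ aᵢ (vᵢ , 1) = (m , h)  in M ⊕ ℤ.
Combination : ∀ {d n} → (Fin n → Lattice d) → (Fin n → ℚ) → Lattice d × ℤ → Set
Combination {d} {n} v a (m , h) =
  (∀ j → ∑[ i < n ] (a i * toℚ (lookup (v i) j)) ≡ toℚ (lookup m j)) ×
  ∑[ i < n ] a i ≡ toℚ h

AffinelyIndependent : ∀ {d n} → (Fin n → Lattice d) → Set
AffinelyIndependent {d} v =
  ∀ a → Combination v a (Vec.replicate d 0ℤ , 0ℤ) → ∀ i → a i ≡ 0ℚ

record Simplex (d : ℕ) : Set where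
  field
    vertex      : Fin (suc d) → Lattice d
    independent : AffinelyIndependent vertex

open Simplex public

-- Faces of a simplex, including the empty one, are identified with subsets S
-- of its vertex set; the face has dimension size S - 1.  InDilate Δ S k m says
-- that m lies in k F for the face F spanned by S.  For S = ∅ this leaves only
-- the point 0 at k = 0, so that the convention h*(∅ , t) = 1 is an instance of
-- the general formula below.
InDilate : ∀ {d} → Simplex d → Subset (suc d) → ℕ → Pred (Lattice d) 0ℓ
InDilate Δ S k m = ∃[ a ]
  (∀ i → 0ℚ ≤ a i) × (∀ i → i ∉ₛ S → a i ≡ 0ℚ) × Combination (vertex Δ) a (m , + k)

-- The fractional part {q} ∈ [0 , 1).  (The library's fracPart rounds towards
-- zero and differs from this on negative arguments.)
frac : ℚ → ℚ
frac q = q - toℚ (floor q)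

-- Elements of (ℚ/ℤ)^{d+1} are given by representatives x; only frac ∘ x matters.
Λ : ∀ {d} → Simplex d → Pred (Fin (suc d) → ℚ) 0ℓ
Λ Δ x = ∃[ p ] Combination (vertex Δ) (frac ∘ x) p

record Enumeration {A : Set} (P : Pred A 0ℓ) : Set where
  field
    elements : List A
    unique   : Unique elements
    exact    : ∀ x → x ∈ elements ⇔ P x

record IsLCM (P : Pred ℕ 0ℓ) (N : ℕ) : Set where
  field
    nonZero        : NonZero N
    commonMultiple : ∀ {k} → P k → k ∣ N
    least          : ∀ {M} → (∀ {k} → P k → k ∣ M) → N ∣ M

IsDenominator : ∀ {d} → Simplex d → Pred ℕ 0ℓ
IsDenominator Δ k = ∃[ x ] Λ Δ x × ∃[ i ] k ≡ ↧ₙ (frac (x i))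

mk : ℤ → ℚ
mk z = mkℚ z 0 (coprime-sym (1-coprimeTo _))

toℚ-mk : ∀ z → toℚ z ≡ mk z
toℚ-mk z = ℚ.↥p/↧p≡p (mk z)

toℚ-+ : ∀ a b → toℚ (a ℤ.+ b) ≡ toℚ a + toℚ b
toℚ-+ a b = ℚ.toℚᵘ-injective (begin
  toℚᵘ (toℚ (a ℤ.+ b))              ≈⟨ ℚ.toℚᵘ-fromℚᵘ (mkℚᵘ (a ℤ.+ b) 0) ⟩
  mkℚᵘ (a ℤ.+ b) 0                  ≈⟨ *≡* (cong (ℤ._* + 1) (sym (cong₂ ℤ._+_ (ℤ.*-identityʳ a) (ℤ.*-identityʳ b)))) ⟩
  mkℚᵘ a 0 ℚᵘ.+ mkℚᵘ b 0            ≈⟨ ℚᵘ.+-cong (ℚ.toℚᵘ-fromℚᵘ (mkℚᵘ a 0)) (ℚ.toℚᵘ-fromℚᵘ (mkℚᵘ b 0)) ⟨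
  toℚᵘ (toℚ a) ℚᵘ.+ toℚᵘ (toℚ b)    ≈⟨ ℚ.toℚᵘ-homo-+ (toℚ a) (toℚ b) ⟨
  toℚᵘ (toℚ a + toℚ b)              ∎)
  where open ℚᵘ.≃-Reasoning

toℚ-* : ∀ a b → toℚ (a ℤ.* b) ≡ toℚ a * toℚ b
toℚ-* a b = ℚ.toℚᵘ-injective (begin
  toℚᵘ (toℚ (a ℤ.* b))              ≈⟨ ℚ.toℚᵘ-fromℚᵘ (mkℚᵘ (a ℤ.* b) 0) ⟩
  mkℚᵘ a 0 ℚᵘ.* mkℚᵘ b 0            ≈⟨ ℚᵘ.*-cong (ℚ.toℚᵘ-fromℚᵘ (mkℚᵘ a 0)) (ℚ.toℚᵘ-fromℚᵘ (mkℚᵘ b 0)) ⟨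
  toℚᵘ (toℚ a) ℚᵘ.* toℚᵘ (toℚ b)    ≈⟨ ℚ.toℚᵘ-homo-* (toℚ a) (toℚ b) ⟨
  toℚᵘ (toℚ a * toℚ b)              ∎)
  where open ℚᵘ.≃-Reasoning

toℚ-neg : ∀ a → toℚ (ℤ.- a) ≡ - toℚ a
toℚ-neg a = ℚ.toℚᵘ-injective (begin
  toℚᵘ (toℚ (ℤ.- a))    ≈⟨ ℚ.toℚᵘ-fromℚᵘ (mkℚᵘ (ℤ.- a) 0) ⟩
  ℚᵘ.- mkℚᵘ a 0         ≈⟨ ℚᵘ.-‿cong (ℚ.toℚᵘ-fromℚᵘ (mkℚᵘ a 0)) ⟨
  ℚᵘ.- toℚᵘ (toℚ a)     ≈⟨ ℚ.toℚᵘ-homo‿- (toℚ a) ⟨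
  toℚᵘ (- toℚ a)        ∎)
  where open ℚᵘ.≃-Reasoning

toℚ-mono-≤ : ∀ {a b} → a ℤ.≤ b → toℚ a ≤ toℚ b
toℚ-mono-≤ {a} {b} a≤b rewrite toℚ-mk a | toℚ-mk b = *≤* (ℤ.*-monoʳ-≤-nonNeg (+ 1) a≤b)

toℚ-cancel-≤ : ∀ {a b} → toℚ a ≤ toℚ b → a ℤ.≤ b
toℚ-cancel-≤ {a} {b} p rewrite toℚ-mk a | toℚ-mk b with p
... | *≤* q = ℤ.*-cancelʳ-≤-pos a b (+ 1) q

toℚ-cancel-< : ∀ {a b} → toℚ a < toℚ b → a ℤ.< b
toℚ-cancel-< {a} {b} p rewrite toℚ-mk a | toℚ-mk b with p
... | *<* q = ℤ.*-cancelʳ-<-nonNeg (+ 1) q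

toℚ-injective : ∀ {a b} → toℚ a ≡ toℚ b → a ≡ b
toℚ-injective e = ℤ.≤-antisym (toℚ-cancel-≤ (ℚ.≤-reflexive e)) (toℚ-cancel-≤ (ℚ.≤-reflexive (sym e)))

floor-≤ : ∀ q → toℚ (floor q) ≤ q
floor-≤ q@(mkℚ n d _) rewrite toℚ-mk (floor q) =
  *≤* (ℤ.≤-trans (ℤ.[n/d]*d≤n n (+ suc d)) (ℤ.≤-reflexive (sym (ℤ.*-identityʳ n))))

<-floor : ∀ q → q < toℚ (ℤ.suc (floor q))
<-floor q@(mkℚ n d _) rewrite toℚ-mk (ℤ.suc (floor q)) =
  *<* (subst (ℤ._< ℤ.suc (floor q) ℤ.* + suc d) (sym (ℤ.*-identityʳ n))
    (subst (λ z → n ℤ.< ℤ.suc z ℤ.* + suc d) (sym (ℤ.div-pos-is-/ℕ n (suc d))) (ℤ.n<s[n/ℕd]*d n (suc d))))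

0≤frac : ∀ q → 0ℚ ≤ frac q
0≤frac q = subst (_≤ frac q) (ℚ.+-inverseʳ (toℚ (floor q))) (ℚ.+-monoˡ-≤ (- toℚ (floor q)) (floor-≤ q))

frac<1 : ∀ q → frac q < 1ℚ
frac<1 q = subst (frac q <_) eq (ℚ.+-monoˡ-< (- toℚ (floor q)) (<-floor q))
  where
  open +-*-Solver
  f = floor q
  eq : toℚ (ℤ.suc f) - toℚ f ≡ 1ℚ
  eq = trans (cong (_- toℚ f) (toℚ-+ (+ 1) f))
    (solve 1 (λ x → con 1ℚ :+ x :- x := con 1ℚ) refl (toℚ f))

frac-id : ∀ {q} → 0ℚ ≤ q → q < 1ℚ → frac q ≡ q
frac-id {q} 0≤q q<1 = trans (cong (λ z → q - toℚ z) f≡0) (ℚ.+-identityʳ q)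
  where
  zero-unique : ∀ z → z ℤ.< + 1 → + 0 ℤ.< ℤ.suc z → z ≡ + 0
  zero-unique (+ zero)           _                        _         = refl
  zero-unique (+ suc n)          (ℤ.+<+ (ℕ.s≤s ()))       _
  zero-unique -[1+ zero ]        _                        (ℤ.+<+ ())
  zero-unique -[1+ suc n ]       _                        ()
  f≡0 : floor q ≡ + 0
  f≡0 = zero-unique (floor q) (toℚ-cancel-< (ℚ.≤-<-trans (floor-≤ q) q<1)) (toℚ-cancel-< (ℚ.≤-<-trans 0≤q (<-floor q)))

Relation : ∀ {m n} → (Fin m → Fin n → ℚ) → (Fin m → ℚ) → Set
Relation {m} u c = ∀ j → ∑[ i < m ] (c i * u i j) ≡ 0ℚ

sum-zero : ∀ {n} {f : Fin n → ℚ} → (∀ i → f i ≡ 0ℚ) → sum f ≡ 0ℚ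
sum-zero {n} e = trans (sum-cong-≗ e) (sum-replicate-zero n)

dependent : ∀ n (u : Fin (suc n) → Fin n → ℚ) → ∃[ c ] (∃[ i ] c i ≢ 0ℚ) × Relation u c
dependent zero    u = (λ _ → 1ℚ) , (zero , λ ()) , λ ()
dependent (suc n) u with Fin.any? (λ i → ¬? (u i zero ℚ.≟ 0ℚ))
... | no none = c′ , (suc (proj₁ c≢0) , proj₂ c≢0) , rel
  where
  ih  = dependent n (λ i j → u (suc i) (suc j))
  c   = proj₁ ih
  c≢0 = proj₁ (proj₂ ih)
  c′ : Fin (suc (suc n)) → ℚ
  c′ zero    = 0ℚ
  c′ (suc i) = c i
  column₀ : ∀ i → u i zero ≡ 0ℚ
  column₀ i = Dec.decidable-stable (u i zero ℚ.≟ 0ℚ) (λ ne → none (i , ne))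
  rel : Relation u c′
  rel zero    = sum-zero (λ i → trans (cong (c′ i *_) (column₀ i)) (ℚ.*-zeroʳ (c′ i)))
  rel (suc j) = trans (cong (_+ sum (λ i → c i * u (suc i) (suc j))) (ℚ.*-zeroˡ (u zero (suc j))))
                  (trans (ℚ.+-identityˡ _) (proj₂ (proj₂ ih) j))
... | yes (p , up≢0) = c′ , (punchIn p (proj₁ c≢0) , λ e → proj₂ c≢0 (trans (sym (c′-other _)) e)) , rel
  where
  open ≡-Reasoning
  instance
    _ = ≢-nonZero up≢0
  pivot : ℚ
  pivot = u p zero
  o : Fin (suc n) → Fin (suc n) → ℚ
  o i j = u (punchIn p i) j
  r : Fin (suc n) → ℚ
  r i = o i zero * 1/ pivot
  ih  = dependent n (λ i j → o i (suc j) - r i * u p (suc j))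
  c   = proj₁ ih
  c≢0 = proj₁ (proj₂ ih)
  s : ℚ
  s = sum (λ i → c i * r i)
  c′ : Fin (suc (suc n)) → ℚ
  c′ = insertAt c p (- s)
  c′-pivot : c′ p ≡ - s
  c′-pivot = VF.insertAt-lookup c p (- s)
  c′-other : ∀ i → c′ (punchIn p i) ≡ c i
  c′-other i = VF.insertAt-punchIn c p (- s) i
  reduced : ∀ j → sum (λ i → c i * (o i j - r i * u p j)) ≡ 0ℚ → sum (λ i → c′ i * u i j) ≡ 0ℚ
  reduced j h = begin
    sum (λ i → c′ i * u i j)
      ≡⟨ sum-remove {i = p} (λ i → c′ i * u i j) ⟩
    c′ p * x + sum (λ i → c′ (punchIn p i) * o i j)
      ≡⟨ cong₂ _+_ (cong (_* x) c′-pivot) (sum-cong-≗ (λ i → cong (_* o i j) (c′-other i))) ⟩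
    - s * x + sum (λ i → c i * o i j)
      ≡⟨ cong (_+_ (- s * x)) (sum-cong-≗ (λ i → split (c i) (o i j) (r i) x)) ⟩
    - s * x + sum (λ i → c i * (o i j - r i * x) + x * (c i * r i))
      ≡⟨ cong (_+_ (- s * x)) (∑-distrib-+ (λ i → c i * (o i j - r i * x)) (λ i → x * (c i * r i))) ⟩
    - s * x + (sum (λ i → c i * (o i j - r i * x)) + sum (λ i → x * (c i * r i)))
      ≡⟨ cong₂ (λ y z → - s * x + (y + z)) h (sym (*-distribˡ-sum x (λ i → c i * r i))) ⟩
    - s * x + (0ℚ + x * s)
      ≡⟨ cancel s x ⟩
    0ℚ ∎
    where
    open +-*-Solver
    x = u p j
    split : ∀ c o r x → c * o ≡ c * (o - r * x) + x * (c * r)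
    split = solve 4 (λ c o r x → c :* o := c :* (o :- r :* x) :+ x :* (c :* r)) refl
    cancel : ∀ s x → - s * x + (0ℚ + x * s) ≡ 0ℚ
    cancel = solve 2 (λ s x → :- s :* x :+ (con 0ℚ :+ x :* s) := con 0ℚ) refl
  column₀ : ∀ i → c i * (o i zero - r i * pivot) ≡ 0ℚ
  column₀ i = begin
    c i * (o i zero - o i zero * 1/ pivot * pivot)   ≡⟨ cong (λ z → c i * (o i zero - z)) (ℚ.*-assoc (o i zero) (1/ pivot) pivot) ⟩
    c i * (o i zero - o i zero * (1/ pivot * pivot)) ≡⟨ cong (λ z → c i * (o i zero - o i zero * z)) (ℚ.*-inverseˡ pivot) ⟩
    c i * (o i zero - o i zero * 1ℚ)                 ≡⟨ solve 2 (λ c o → c :* (o :- o :* con 1ℚ) := con 0ℚ) refl (c i) (o i zero) ⟩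
    0ℚ ∎
    where open +-*-Solver
  rel : Relation u c′
  rel zero    = reduced zero (sum-zero column₀)
  rel (suc j) = reduced (suc j) (proj₂ (proj₂ ih) j)

module _ {d} (Δ : Simplex d) where

  open ≡-Reasoning

  private
    v = vertex Δ

  coordinates-unique : ∀ {a b p} → Combination v a p → Combination v b p → a ≗ b
  coordinates-unique {a} {b} {m , h} (am , ah) (bm , bh) i =
    x∙y⁻¹≈ε⇒x≈y (a i) (b i) (independent Δ (λ i → a i - b i) (vectors , heights) i)
    where
    difference : ∀ {n} (f g : Fin n → ℚ) {z} → sum f ≡ z → sum g ≡ z → sum (λ i → f i - g i) ≡ 0ℚ
    difference f g {z} ef eg = begin
      sum (λ i → f i - g i)               ≡⟨ ∑-distrib-+ f (λ i → - g i) ⟩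
      sum f + sum (λ i → - g i)           ≡⟨ cong₂ _+_ ef (sum-cong-≗ (λ i → negate (g i))) ⟩
      z + sum (λ i → - 1ℚ * g i)          ≡⟨ cong (λ y → z + y) (sym (*-distribˡ-sum (- 1ℚ) g)) ⟩
      z + - 1ℚ * sum g                    ≡⟨ cong (λ y → z + - 1ℚ * y) eg ⟩
      z + - 1ℚ * z                        ≡⟨ solve 1 (λ z → z :+ con (- 1ℚ) :* z := con 0ℚ) refl z ⟩
      0ℚ ∎
      where
      open +-*-Solver
      negate : ∀ x → - x ≡ - 1ℚ * x
      negate = solve 1 (λ x → :- x := con (- 1ℚ) :* x) refl
    heights = difference a b ah bh
    vectors : ∀ j → sum (λ i → (a i - b i) * toℚ (lookup (v i) j)) ≡ toℚ (lookup (Vec.replicate d 0ℤ) j)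
    vectors j = begin
      sum (λ i → (a i - b i) * x i)       ≡⟨ sum-cong-≗ (λ i → distrib (a i) (b i) (x i)) ⟩
      sum (λ i → a i * x i - b i * x i)   ≡⟨ difference (λ i → a i * x i) (λ i → b i * x i) (am j) (bm j) ⟩
      toℚ 0ℤ                              ≡⟨ cong toℚ (sym (Vec.lookup-replicate j 0ℤ)) ⟩
      toℚ (lookup (Vec.replicate d 0ℤ) j) ∎
      where
      open +-*-Solver
      x : Fin (suc d) → ℚ
      x i = toℚ (lookup (v i) j)
      distrib : ∀ a b x → (a - b) * x ≡ a * x - b * x
      distrib = solve 3 (λ a b x → (a :- b) :* x := a :* x :- b :* x) refl

  solveSystem : ∀ p → ∃[ a ] Combination v a p
  solveSystem (m , h) = (λ i → - (c (suc i) * 1/ c₀)) , (λ j → solved (suc j)) , heights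
    where
    -- (m , h) and the (vᵢ , 1), with the height as coordinate zero
    u : Fin (suc (suc d)) → Fin (suc d) → ℚ
    u zero    zero    = toℚ h
    u zero    (suc j) = toℚ (lookup m j)
    u (suc i) zero    = 1ℚ
    u (suc i) (suc j) = toℚ (lookup (v i) j)
    relation = dependent (suc d) u
    c   = proj₁ relation
    rel = proj₂ (proj₂ relation)
    c₀  = c zero
    drop₀ : ∀ j → c₀ ≡ 0ℚ → sum (λ i → c (suc i) * u (suc i) j) ≡ 0ℚ
    drop₀ j e = begin
      s                  ≡⟨ solve 2 (λ s y → s := con 0ℚ :* y :+ s) refl s (u zero j) ⟩
      0ℚ * u zero j + s  ≡⟨ cong (λ z → z * u zero j + s) (sym e) ⟩
      c₀ * u zero j + s  ≡⟨ rel j ⟩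
      0ℚ                 ∎
      where
      open +-*-Solver
      s = sum (λ i → c (suc i) * u (suc i) j)
    c₀≢0 : c₀ ≢ 0ℚ
    c₀≢0 e = proj₂ (proj₁ (proj₂ relation)) (vanish (proj₁ (proj₁ (proj₂ relation))))
      where
      vanish : ∀ i → c i ≡ 0ℚ
      vanish zero    = e
      vanish (suc i) = independent Δ (c ∘ suc)
        ( (λ j → trans (drop₀ (suc j) e) (cong toℚ (sym (Vec.lookup-replicate j 0ℤ))))
        , trans (sum-cong-≗ (λ i → sym (ℚ.*-identityʳ (c (suc i))))) (drop₀ zero e)) i
    instance
      _ = ≢-nonZero c₀≢0
    w = 1/ c₀
    solved : ∀ j → sum (λ i → - (c (suc i) * w) * u (suc i) j) ≡ u zero j
    solved j = begin
      sum (λ i → - (c (suc i) * w) * u (suc i) j)     ≡⟨ sum-cong-≗ (λ i → pull (c (suc i)) w (u (suc i) j)) ⟩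
      sum (λ i → - w * (c (suc i) * u (suc i) j))     ≡⟨ sym (*-distribˡ-sum (- w) (λ i → c (suc i) * u (suc i) j)) ⟩
      - w * s                                         ≡⟨ rearrange w s c₀ y ⟩
      w * c₀ * y + - w * (c₀ * y + s)                 ≡⟨ cong₂ (λ α β → α * y + - w * β) (ℚ.*-inverseˡ c₀) (rel j) ⟩
      1ℚ * y + - w * 0ℚ                               ≡⟨ solve 2 (λ y w → con 1ℚ :* y :+ :- w :* con 0ℚ := y) refl y w ⟩
      y ∎
      where
      open +-*-Solver
      s = sum (λ i → c (suc i) * u (suc i) j)
      y = u zero j
      pull : ∀ c w x → - (c * w) * x ≡ - w * (c * x)
      pull = solve 3 (λ c w x → :- (c :* w) :* x := :- w :* (c :* x)) refl
      rearrange : ∀ w s c y → - w * s ≡ w * c * y + - w * (c * y + s)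
      rearrange = solve 4 (λ w s c y → :- w :* s := w :* c :* y :+ :- w :* (c :* y :+ s)) refl
    heights : sum (λ i → - (c (suc i) * w)) ≡ toℚ h
    heights = trans (sum-cong-≗ (λ i → sym (ℚ.*-identityʳ (- (c (suc i) * w))))) (solved zero)

  opaque

    coordinates : ∀ p → ∃[ a ] Combination v a p
    coordinates = solveSystem

ints : ℕ → List ℤ
ints B = map +_ (upTo (suc B)) ++ map -[1+_] (upTo B)

∈-ints : ∀ {B} z → ℤ.∣ z ∣ ℕ.≤ B → z ∈ ints B
∈-ints (+ n)    n≤B = ∈.∈-++⁺ˡ (∈.∈-map⁺ +_ (∈.∈-upTo⁺ (ℕ.s≤s n≤B)))
∈-ints -[1+ n ] n<B = ∈.∈-++⁺ʳ _ (∈.∈-map⁺ -[1+_] (∈.∈-upTo⁺ n<B))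

ints-unique : ∀ B → Unique (ints B)
ints-unique B = Unique.++⁺
  (Unique.map⁺ ℤ.+-injective (Unique.upTo⁺ (suc B)))
  (Unique.map⁺ ℤ.-[1+-injective (Unique.upTo⁺ B))
  disjoint
  where
  disjoint : ∀ {z} → ¬ (z ∈ map +_ (upTo (suc B)) × z ∈ map -[1+_] (upTo B))
  disjoint (p , q) with ∈.∈-map⁻ +_ p | ∈.∈-map⁻ -[1+_] q
  ... | _ , _ , refl | _ , _ , ()

box : ∀ {d} → (Fin d → ℕ) → List (Lattice d)
box {zero}  B = [] ∷ []
box {suc d} B = cartesianProductWith _∷_ (ints (B zero)) (box (B ∘ suc))

∈-box : ∀ {d} {B : Fin d → ℕ} (m : Lattice d) → (∀ j → ℤ.∣ lookup m j ∣ ℕ.≤ B j) → m ∈ box B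
∈-box []      _ = here refl
∈-box (z ∷ m) b = ∈.∈-cartesianProductWith⁺ _∷_ (∈-ints z (b zero)) (∈-box m (b ∘ suc))

box-unique : ∀ {d} (B : Fin d → ℕ) → Unique (box B)
box-unique {zero}  B = [] AllPairs.∷ AllPairs.[]
box-unique {suc d} B = Unique.cartesianProductWith⁺ _∷_ Vec.∷-injective (ints-unique (B zero)) (box-unique (B ∘ suc))

absSum : ∀ {n} → ℕ → (Fin n → ℤ) → ℕ
absSum {zero}  K x = 0
absSum {suc n} K x = K ℕ.* ℤ.∣ x zero ∣ ℕ.+ absSum K (x ∘ suc)

∣toℚ∣ : ∀ z → ∣ toℚ z ∣ ≡ toℚ (+ ℤ.∣ z ∣)
∣toℚ∣ z rewrite toℚ-mk z | toℚ-mk (+ ℤ.∣ z ∣) = refl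

sum-bound : ∀ {n} K (a : Fin n → ℚ) (x : Fin n → ℤ) → (∀ i → 0ℚ ≤ a i) → (∀ i → a i ≤ toℚ (+ K)) →
  ∣ sum (λ i → a i * toℚ (x i)) ∣ ≤ toℚ (+ absSum K x)
sum-bound {zero}  K a x 0≤a a≤K = ℚ.≤-refl
sum-bound {suc n} K a x 0≤a a≤K = begin
  ∣ a zero * y + s ∣                                      ≤⟨ ℚ.∣p+q∣≤∣p∣+∣q∣ (a zero * y) s ⟩
  ∣ a zero * y ∣ + ∣ s ∣                                  ≡⟨ cong (_+ ∣ s ∣) (trans (ℚ.∣p*q∣≡∣p∣*∣q∣ (a zero) y) (cong (_* ∣ y ∣) (ℚ.0≤p⇒∣p∣≡p (0≤a zero)))) ⟩
  a zero * ∣ y ∣ + ∣ s ∣                                  ≤⟨ ℚ.+-mono-≤ (ℚ.*-monoʳ-≤-nonNeg ∣ y ∣ {{ℚ.∣-∣-nonNeg y}} (a≤K zero)) (sum-bound K (a ∘ suc) (x ∘ suc) (0≤a ∘ suc) (a≤K ∘ suc)) ⟩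
  toℚ (+ K) * ∣ y ∣ + toℚ (+ absSum K (x ∘ suc))          ≡⟨ cong (λ z → toℚ (+ K) * z + toℚ (+ absSum K (x ∘ suc))) (∣toℚ∣ (x zero)) ⟩
  toℚ (+ K) * toℚ (+ ℤ.∣ x zero ∣) + toℚ (+ absSum K (x ∘ suc)) ≡⟨ cong (_+ toℚ (+ absSum K (x ∘ suc))) (sym (trans (cong toℚ (ℤ.pos-* K ℤ.∣ x zero ∣)) (toℚ-* (+ K) (+ ℤ.∣ x zero ∣)))) ⟩
  toℚ (+ (K ℕ.* ℤ.∣ x zero ∣)) + toℚ (+ absSum K (x ∘ suc)) ≡⟨ sym (trans (cong toℚ (ℤ.pos-+ (K ℕ.* ℤ.∣ x zero ∣) (absSum K (x ∘ suc)))) (toℚ-+ (+ (K ℕ.* ℤ.∣ x zero ∣)) (+ absSum K (x ∘ suc)))) ⟩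
  toℚ (+ absSum K x)                                      ∎
  where
  open ℚ.≤-Reasoning
  y = toℚ (x zero)
  s = sum (λ i → a (suc i) * toℚ (x (suc i)))

bounded : ∀ {n} K (a : Fin n → ℚ) (x : Fin n → ℤ) z → (∀ i → 0ℚ ≤ a i) → (∀ i → a i ≤ toℚ (+ K)) →
  sum (λ i → a i * toℚ (x i)) ≡ toℚ z → ℤ.∣ z ∣ ℕ.≤ absSum K x
bounded K a x z 0≤a a≤K e = ℤ.drop‿+≤+ (toℚ-cancel-≤
  (subst (_≤ toℚ (+ absSum K x)) (trans (cong ∣_∣ e) (∣toℚ∣ z)) (sum-bound K a x 0≤a a≤K)))

0≤sum : ∀ {n} (a : Fin n → ℚ) → (∀ i → 0ℚ ≤ a i) → 0ℚ ≤ sum a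
0≤sum {zero}  a 0≤a = ℚ.≤-refl
0≤sum {suc n} a 0≤a = ℚ.+-mono-≤ (0≤a zero) (0≤sum (a ∘ suc) (0≤a ∘ suc))

term≤sum : ∀ {n} (a : Fin n → ℚ) → (∀ i → 0ℚ ≤ a i) → ∀ i → a i ≤ sum a
term≤sum {suc n} a 0≤a i = begin
  a i                                  ≡⟨ sym (ℚ.+-identityʳ (a i)) ⟩
  a i + 0ℚ                             ≤⟨ ℚ.+-monoʳ-≤ (a i) (0≤sum (a ∘ punchIn i) (0≤a ∘ punchIn i)) ⟩
  a i + sum (a ∘ punchIn i)            ≡⟨ sym (sum-remove {i = i} a) ⟩
  sum a                                ∎
  where open ℚ.≤-Reasoning

module _ {d} (Δ : Simplex d) where

  private
    v = vertex Δ

    InFace : Subset (suc d) → (Fin (suc d) → ℚ) → Set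
    InFace S a = (∀ i → 0ℚ ≤ a i) × (∀ i → i ∉ₛ S → a i ≡ 0ℚ)

    inFace? : ∀ S a → Dec (InFace S a)
    inFace? S a = Fin.all? (λ i → 0ℚ ℚ.≤? a i) ×-dec Fin.all? (λ i → ¬? (i ∈? S) →-dec (a i ℚ.≟ 0ℚ))

    toDilate : ∀ S k m → InFace S (proj₁ (coordinates Δ (m , + k))) → InDilate Δ S k m
    toDilate S k m (0≤a , supp) = proj₁ (coordinates Δ (m , + k)) , 0≤a , supp , proj₂ (coordinates Δ (m , + k))

    fromDilate : ∀ S k m → InDilate Δ S k m → InFace S (proj₁ (coordinates Δ (m , + k)))
    fromDilate S k m (b , 0≤b , supp , comb) =
      (λ i → subst (0ℚ ≤_) (b≗a i) (0≤b i)) , (λ i i∉S → trans (sym (b≗a i)) (supp i i∉S))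
      where
      b≗a : b ≗ proj₁ (coordinates Δ (m , + k))
      b≗a = coordinates-unique Δ {p = m , + k} comb (proj₂ (coordinates Δ (m , + k)))

    inDilate? : ∀ S k m → Dec (InDilate Δ S k m)
    inDilate? S k m = Dec.map′ (toDilate S k m) (fromDilate S k m) (inFace? S (proj₁ (coordinates Δ (m , + k))))

    bounds : ℕ → Fin d → ℕ
    bounds K j = absSum K (λ i → lookup (v i) j)

  opaque

    facePoints : ∀ S k → Enumeration (InDilate Δ S k)
    facePoints S k = record
      { elements = filter (inDilate? S k) (box (bounds k))
      ; unique   = Unique.filter⁺ (inDilate? S k) (box-unique (bounds k))
      ; exact    = λ m → mk⇔
          (λ m∈ → proj₂ (∈.∈-filter⁻ (inDilate? S k) {xs = box (bounds k)} m∈))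
          (λ m∈kF@(a , 0≤a , _ , am , ak) → ∈.∈-filter⁺ (inDilate? S k)
            (∈-box m (λ j → bounded k a (λ i → lookup (v i) j) (lookup m j) 0≤a
              (λ i → subst (a i ≤_) ak (term≤sum a 0≤a i)) (am j)))
            m∈kF)
      }

  private
    Fundamental : Pred (Lattice d × ℤ) 0ℓ
    Fundamental p = ∀ i → 0ℚ ≤ proj₁ (coordinates Δ p) i × proj₁ (coordinates Δ p) i < 1ℚ

    fundamental? : ∀ p → Dec (Fundamental p)
    fundamental? p = Fin.all? (λ i → (0ℚ ℚ.≤? proj₁ (coordinates Δ p) i) ×-dec (proj₁ (coordinates Δ p) i ℚ.<? 1ℚ))

    candidates : List (Lattice d × ℤ)
    candidates = cartesianProduct (box (bounds 1)) (ints (absSum {suc d} 1 (λ _ → + 1)))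

    denominatorsOf : Lattice d × ℤ → List ℕ
    denominatorsOf p = List.tabulate (λ i → ↧ₙ (proj₁ (coordinates Δ p) i))

    denominators : List ℕ
    denominators = concatMap denominatorsOf (filter fundamental? candidates)

    sound : ∀ {k} → k ∈ denominators → IsDenominator Δ k
    sound k∈ with find (∈.∈-concatMap⁻ denominatorsOf {xs = filter fundamental? candidates} k∈)
    ... | p , p∈ , k∈p with ∈.∈-filter⁻ fundamental? {xs = candidates} p∈ | ∈.∈-tabulate⁻ {f = λ i → ↧ₙ (proj₁ (coordinates Δ p) i)} k∈p
    ... | _ , fund | i , refl = a , (p , combination-cong (sym ∘ frac-a) comb) , i , cong ↧ₙ_ (sym (frac-a i))
      where
      a    = proj₁ (coordinates Δ p)
      comb = proj₂ (coordinates Δ p)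
      frac-a : ∀ i → frac (a i) ≡ a i
      frac-a i = frac-id (proj₁ (fund i)) (proj₂ (fund i))
      combination-cong : ∀ {b} → a ≗ b → Combination v a p → Combination v b p
      combination-cong a≗b (am , ah) =
        (λ j → trans (sum-cong-≗ (λ i → cong (_* toℚ (lookup (v i) j)) (sym (a≗b i)))) (am j)) ,
        trans (sum-cong-≗ (λ i → sym (a≗b i))) ah

    complete : ∀ {k} → IsDenominator Δ k → k ∈ denominators
    complete (x , (p@(m , h) , comb@(xm , xh)) , i , refl) =
      ∈.∈-concatMap⁺ denominatorsOf (lose (∈.∈-filter⁺ fundamental? p∈ fund)
        (subst (_∈ denominatorsOf p) (cong ↧ₙ_ (sym (f≗a i))) (∈.∈-tabulate⁺ {f = λ i → ↧ₙ (proj₁ (coordinates Δ p) i)} i)))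
      where
      a = proj₁ (coordinates Δ p)
      f≗a : frac ∘ x ≗ a
      f≗a = coordinates-unique Δ {p = p} comb (proj₂ (coordinates Δ p))
      fund : Fundamental p
      fund i = subst (0ℚ ≤_) (f≗a i) (0≤frac (x i)) , subst (_< 1ℚ) (f≗a i) (frac<1 (x i))
      f≤1 : ∀ i → frac (x i) ≤ toℚ (+ 1)
      f≤1 i = ℚ.<⇒≤ (frac<1 (x i))
      p∈ : p ∈ candidates
      p∈ = ∈.∈-cartesianProduct⁺
        (∈-box m (λ j → bounded 1 (frac ∘ x) (λ i → lookup (v i) j) (lookup m j) (0≤frac ∘ x) f≤1 (xm j)))
        (∈-ints h (bounded 1 (frac ∘ x) (λ _ → + 1) h (0≤frac ∘ x) f≤1
          (trans (sum-cong-≗ (λ i → ℚ.*-identityʳ (frac (x i)))) xh)))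

    lcms : List ℕ → ℕ
    lcms = foldr lcm 1

    lcms-multiple : ∀ {k ks} → k ∈ ks → k ∣ lcms ks
    lcms-multiple {ks = l ∷ ls} (here refl) = m∣lcm[m,n] l (lcms ls)
    lcms-multiple {ks = l ∷ ls} (there k∈)  = ∣-trans (lcms-multiple k∈) (n∣lcm[m,n] l (lcms ls))

    lcms-least : ∀ {M} ks → (∀ {k} → k ∈ ks → k ∣ M) → lcms ks ∣ M
    lcms-least []       _ = 1∣ _
    lcms-least (k ∷ ks) f = lcm-least (f (here refl)) (lcms-least ks (f ∘ there))

    lcm-nonZero : ∀ m n → NonZero m → NonZero n → NonZero (lcm m n)
    lcm-nonZero m n m≢0 n≢0 = ℕ.≢-nonZero (λ e → ℕ.≢-nonZero⁻¹ (m ℕ.* n) {{ℕ.m*n≢0 m n {{m≢0}} {{n≢0}}}}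
      (0∣⇒≡0 (subst (_∣ m ℕ.* n) e (lcm-least {m} {n} (m∣m*n n) (n∣m*n m)))))

    lcms-nonZero : ∀ ks → (∀ {k} → k ∈ ks → NonZero k) → NonZero (lcms ks)
    lcms-nonZero []       _ = _
    lcms-nonZero (k ∷ ks) f = lcm-nonZero k (lcms ks) (f (here refl)) (lcms-nonZero ks (f ∘ there))

    denominator-nonZero : ∀ {k} → IsDenominator Δ k → NonZero k
    denominator-nonZero (x , _ , i , refl) with frac (x i)
    ... | mkℚ _ _ _ = _

  opaque

    denominatorLCM : ∃ (IsLCM (IsDenominator Δ))
    denominatorLCM = lcms denominators , record
      { nonZero        = lcms-nonZero denominators (λ k∈ → denominator-nonZero (sound k∈))
      ; commonMultiple = λ k → lcms-multiple (complete k)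
      ; least          = λ f → lcms-least denominators (λ k∈ → f (sound k∈))
      }

-- |k F ∩ M|; the enumeration facePoints is opaque because only its type matters.
ehrhart : ∀ {d} → Simplex d → Subset (suc d) → ℕ → ℕ
ehrhart Δ S k = length (Enumeration.elements (facePoints Δ S k))

-- Power series and polynomials in t are given by their coefficient sequences.
Series : Set
Series = ℕ → ℤ

times[1-t]^ : ℕ → Series → Series
times[1-t]^ zero    f k       = f k
times[1-t]^ (suc n) f zero    = times[1-t]^ n f zero
times[1-t]^ (suc n) f (suc k) = times[1-t]^ n f (suc k) ℤ.- times[1-t]^ n f k

-- h*(F , t) = (1 - t)^{dim F + 1} ∑ₖ |k F ∩ M| t^k
hStar : ∀ {d} → Simplex d → Subset (suc d) → Series
hStar Δ S = times[1-t]^ (size S) (λ k → + ehrhart Δ S k)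

subsets : ∀ n → List (Subset n)
subsets zero    = [] ∷ []
subsets (suc n) = map (outside ∷_) (subsets n) ++ map (inside ∷_) (subsets n)

-- dim Δ - dim F = d - (size S - 1)
localHStar : ∀ {d} → Simplex d → Series
localHStar {d} Δ j = foldr ℤ._+_ 0ℤ
  (map (λ S → (-1ℤ ℤ.^ (suc d ℕ.∸ size S)) ℤ.* hStar Δ S j) (subsets (suc d)))

Thin : ∀ {d} → Simplex d → Set
Thin Δ = ∀ j → localHStar Δ j ≡ 0ℤ

Word : ℕ → ℕ → Set
Word N n = Fin n → Fin N

record LinearCode (N n : ℕ) .{{_ : NonZero N}} : Set₁ where
  field
    IsWord      : Pred (Word N n) 0ℓ
    zero-closed : IsWord (λ _ → 0 mod N)
    +-closed    : ∀ {c c′} → IsWord c → IsWord c′ → IsWord (λ i → (toℕ (c i) ℕ.+ toℕ (c′ i)) mod N)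
    *-closed    : ∀ (r : Fin N) {c} → IsWord c → IsWord (λ i → (toℕ r ℕ.* toℕ (c i)) mod N)

record ExtendedCode (N n : ℕ) .{{_ : NonZero N}} : Set₁ where
  field
    linearCode : LinearCode N n
  open LinearCode linearCode public
  field
    extended : ∀ {c} → IsWord c → N ∣ sumℕ (λ i → toℕ (c i))

ThinCode : ∀ {N n} .{{_ : NonZero N}} → ExtendedCode N n → Set
ThinCode C = ¬ (∃[ c ] ExtendedCode.IsWord C c × (∀ i → toℕ (c i) ≢ 0))

modulus : ∀ {d} → Simplex d → ℕ
modulus Δ = proj₁ (denominatorLCM Δ)

instance
  modulus-nonZero : ∀ {d} {Δ : Simplex d} → NonZero (modulus Δ)
  modulus-nonZero {Δ = Δ} = IsLCM.nonZero (proj₂ (denominatorLCM Δ))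

IsCodeWord : ∀ {d} (Δ : Simplex d) → Pred (Word (modulus Δ) (suc d)) 0ℓ
IsCodeWord Δ c = ∃[ x ] Λ Δ x × (∀ i → toℚ (+ toℕ (c i)) ≡ toℚ (+ modulus Δ) * frac (x i))

module _ {d} (Δ : Simplex d) where

  open ≡-Reasoning

  private
    v = vertex Δ
    N = modulus Δ

    record Integral {n} (f : Fin n → ℚ) : Set where
      constructor integral
      field
        total : ℤ
        sum≡  : sum f ≡ toℚ total

    open Integral

    integral-+ : ∀ {n} {f g : Fin n → ℚ} → Integral f → Integral g → Integral (λ i → f i + g i)
    integral-+ {f = f} {g} (integral y ey) (integral z ez) =
      integral (y ℤ.+ z) (trans (∑-distrib-+ f g) (trans (cong₂ _+_ ey ez) (sym (toℚ-+ y z))))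

    integral-* : ∀ {n} (r : ℤ) {f : Fin n → ℚ} → Integral f → Integral (λ i → toℚ r * f i)
    integral-* r {f} (integral z ez) =
      integral (r ℤ.* z) (trans (sym (*-distribˡ-sum (toℚ r) f)) (trans (cong (toℚ r *_) ez) (sym (toℚ-* r z))))

    integral-ℤ : ∀ {n} (z : Fin n → ℤ) → Integral (λ i → toℚ (z i))
    integral-ℤ {zero}  z = integral 0ℤ refl
    integral-ℤ {suc n} z =
      let integral s e = integral-ℤ (z ∘ suc) in
      integral (z zero ℤ.+ s) (trans (cong (λ y → toℚ (z zero) + y) e) (sym (toℚ-+ (z zero) s)))

    integral-≗ : ∀ {n} {f g : Fin n → ℚ} → f ≗ g → Integral f → Integral g
    integral-≗ f≗g (integral z e) = integral z (trans (sym (sum-cong-≗ f≗g)) e)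

    record LatticeCombination (f : Fin (suc d) → ℚ) : Set where
      constructor lattice
      field
        vectors : ∀ j → Integral (λ i → f i * toℚ (lookup (v i) j))
        heights : Integral f

    toCombination : ∀ {f} → LatticeCombination f → ∃[ p ] Combination v f p
    toCombination (lattice m h) = (Vec.tabulate (λ j → total (m j)) , total h) ,
      (λ j → trans (sum≡ (m j)) (cong toℚ (sym (Vec.lookup∘tabulate (λ j → total (m j)) j)))) , sum≡ h

    fromCombination : ∀ {f} p → Combination v f p → LatticeCombination f
    fromCombination (m , h) (em , eh) = lattice (λ j → integral (lookup m j) (em j)) (integral h eh)

    lattice-≗ : ∀ {f g} → f ≗ g → LatticeCombination f → LatticeCombination g
    lattice-≗ f≗g (lattice m h) = lattice
      (λ j → integral-≗ (λ i → cong (_* toℚ (lookup (v i) j)) (f≗g i)) (m j))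
      (integral-≗ f≗g h)

    lattice-+ : ∀ {f g} → LatticeCombination f → LatticeCombination g → LatticeCombination (λ i → f i + g i)
    lattice-+ {f} {g} (lattice m h) (lattice m′ h′) = lattice
      (λ j → integral-≗ (λ i → sym (ℚ.*-distribʳ-+ (toℚ (lookup (v i) j)) (f i) (g i))) (integral-+ (m j) (m′ j)))
      (integral-+ h h′)

    lattice-* : ∀ r {f} → LatticeCombination f → LatticeCombination (λ i → toℚ r * f i)
    lattice-* r {f} (lattice m h) = lattice
      (λ j → integral-≗ (λ i → sym (ℚ.*-assoc (toℚ r) (f i) (toℚ (lookup (v i) j)))) (integral-* r (m j)))
      (integral-* r h)

    lattice-ℤ : ∀ z → LatticeCombination (λ i → toℚ (z i))
    lattice-ℤ z = lattice
      (λ j → integral-≗ (λ i → toℚ-* (z i) (lookup (v i) j)) (integral-ℤ (λ i → z i ℤ.* lookup (v i) j)))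
      (integral-ℤ z)

    reduce : (n : Fin (suc d) → ℕ) (f : Fin (suc d) → ℚ) → LatticeCombination f →
      (∀ i → toℚ (+ n i) ≡ toℚ (+ N) * f i) → IsCodeWord Δ (λ i → n i mod N)
    reduce n f lat e =
      x , toCombination (lattice-≗ (λ i → sym (frac-x i)) (lattice-+ lat (lattice-ℤ (λ i → ℤ.- (+ (n i ℕ./ N)))))) ,
      λ i → trans (cong (λ k → toℚ (+ k)) (Fin.toℕ-fromℕ< (m%n<n (n i) N)))
              (trans (remainder i) (cong (toℚ (+ N) *_) (sym (frac-x i))))
      where
      x : Fin (suc d) → ℚ
      x i = f i + toℚ (ℤ.- (+ (n i ℕ./ N)))
      remainder : ∀ i → toℚ (+ (n i % N)) ≡ toℚ (+ N) * x i
      remainder i = begin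
        toℚ (+ r)                                       ≡⟨ solve 3 (λ r q N → r := r :+ q :* N :- q :* N) refl (toℚ (+ r)) (toℚ (+ q)) M ⟩
        toℚ (+ r) + toℚ (+ q) * M - toℚ (+ q) * M       ≡⟨ cong (_- toℚ (+ q) * M) (trans (sym division) (e i)) ⟩
        M * f i - toℚ (+ q) * M                         ≡⟨ solve 3 (λ f q N → N :* f :- q :* N := N :* (f :- q)) refl (f i) (toℚ (+ q)) M ⟩
        M * (f i - toℚ (+ q))                           ≡⟨ cong (λ y → M * (f i + y)) (sym (toℚ-neg (+ q))) ⟩
        M * x i                                         ∎
        where
        open +-*-Solver
        r = n i % N
        q = n i ℕ./ N
        M = toℚ (+ N)
        division : toℚ (+ n i) ≡ toℚ (+ r) + toℚ (+ q) * M
        division = begin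
          toℚ (+ n i)                          ≡⟨ cong (λ k → toℚ (+ k)) (m≡m%n+[m/n]*n (n i) N) ⟩
          toℚ (+ (r ℕ.+ q ℕ.* N))              ≡⟨ cong toℚ (trans (ℤ.pos-+ r (q ℕ.* N)) (cong (λ y → + r ℤ.+ y) (ℤ.pos-* q N))) ⟩
          toℚ (+ r ℤ.+ + q ℤ.* + N)            ≡⟨ toℚ-+ (+ r) (+ q ℤ.* + N) ⟩
          toℚ (+ r) + toℚ (+ q ℤ.* + N)        ≡⟨ cong (λ y → toℚ (+ r) + y) (toℚ-* (+ q) (+ N)) ⟩
          toℚ (+ r) + toℚ (+ q) * M            ∎
      0<N : 0ℚ < toℚ (+ N)
      0<N = ℚ.≰⇒> λ N≤0 → ℕ.<⇒≱ (ℕ.>-nonZero⁻¹ N) (ℤ.drop‿+≤+ (toℚ-cancel-≤ {+ N} {+ 0} N≤0))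
      instance
        _ = ℚ.positive 0<N
      0≤x : ∀ i → 0ℚ ≤ x i
      0≤x i = ℚ.*-cancelˡ-≤-pos (toℚ (+ N)) (subst (toℚ (+ N) * 0ℚ ≤_) (remainder i)
        (subst (_≤ toℚ (+ (n i % N))) (sym (ℚ.*-zeroʳ (toℚ (+ N)))) (toℚ-mono-≤ {+ 0} {+ (n i % N)} (ℤ.+≤+ ℕ.z≤n))))
      x<1 : ∀ i → x i < 1ℚ
      x<1 i = ℚ.≰⇒> λ 1≤x → ℕ.<⇒≱ (m%n<n (n i) N) (ℤ.drop‿+≤+ (toℚ-cancel-≤ {+ N} {+ (n i % N)}
        (subst (toℚ (+ N) ≤_) (sym (remainder i))
          (subst (_≤ toℚ (+ N) * x i) (ℚ.*-identityʳ (toℚ (+ N)))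
            (ℚ.*-monoˡ-≤-nonNeg (toℚ (+ N)) {{nonNegative (ℚ.<⇒≤ 0<N)}} 1≤x)))))
      frac-x : ∀ i → frac (x i) ≡ x i
      frac-x i = frac-id (0≤x i) (x<1 i)

    word-sum : ∀ {n} (k : Fin n → ℕ) → sum (λ i → toℚ (+ k i)) ≡ toℚ (+ sumℕ k)
    word-sum {zero}  k = refl
    word-sum {suc n} k = trans (cong (λ y → toℚ (+ k zero) + y) (word-sum (k ∘ suc)))
      (sym (trans (cong toℚ (ℤ.pos-+ (k zero) (sumℕ (k ∘ suc)))) (toℚ-+ (+ k zero) (+ sumℕ (k ∘ suc)))))

  code : ExtendedCode (modulus Δ) (suc d)
  code = record
    { linearCode = record
      { IsWord      = IsCodeWord Δ
      ; zero-closed = reduce (λ _ → 0) (λ _ → toℚ 0ℤ) (lattice-ℤ (λ _ → 0ℤ)) (λ _ → sym (ℚ.*-zeroʳ (toℚ (+ N))))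
      ; +-closed    = λ {c} {c′} (x , (p , xp) , ex) (y , (q , yp) , ey) →
          reduce (λ i → toℕ (c i) ℕ.+ toℕ (c′ i)) (λ i → frac (x i) + frac (y i))
            (lattice-+ {frac ∘ x} {frac ∘ y} (fromCombination p xp) (fromCombination q yp))
            (λ i → trans (trans (cong toℚ (ℤ.pos-+ (toℕ (c i)) (toℕ (c′ i)))) (toℚ-+ (+ toℕ (c i)) (+ toℕ (c′ i))))
              (trans (cong₂ _+_ (ex i) (ey i)) (sym (ℚ.*-distribˡ-+ (toℚ (+ N)) (frac (x i)) (frac (y i))))))
      ; *-closed    = λ r {c} (x , (p , xp) , ex) →
          reduce (λ i → toℕ r ℕ.* toℕ (c i)) (λ i → toℚ (+ toℕ r) * frac (x i))
            (lattice-* (+ toℕ r) {frac ∘ x} (fromCombination p xp))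
            (λ i → trans (trans (cong toℚ (ℤ.pos-* (toℕ r) (toℕ (c i)))) (toℚ-* (+ toℕ r) (+ toℕ (c i))))
              (trans (cong (toℚ (+ toℕ r) *_) (ex i)) (swap (toℚ (+ toℕ r)) (toℚ (+ N)) (frac (x i)))))
      }
    ; extended = λ {c} (x , ((_ , h) , _ , xh) , ex) → divides ℤ.∣ h ∣ (begin
        sumℕ (toℕ ∘ c)                       ≡⟨ cong ℤ.∣_∣ (toℚ-injective {+ sumℕ (toℕ ∘ c)} {+ N ℤ.* h} (begin
            toℚ (+ sumℕ (toℕ ∘ c))               ≡⟨ sym (word-sum (toℕ ∘ c)) ⟩
            sum (λ i → toℚ (+ toℕ (c i)))        ≡⟨ sum-cong-≗ ex ⟩
            sum (λ i → toℚ (+ N) * frac (x i))   ≡⟨ sym (*-distribˡ-sum (toℚ (+ N)) (frac ∘ x)) ⟩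
            toℚ (+ N) * sum (frac ∘ x)           ≡⟨ cong (toℚ (+ N) *_) xh ⟩
            toℚ (+ N) * toℚ h                    ≡⟨ sym (toℚ-* (+ N) h) ⟩
            toℚ (+ N ℤ.* h)                      ∎)) ⟩
        ℤ.∣ + N ℤ.* h ∣                      ≡⟨ ℤ.abs-* (+ N) h ⟩
        N ℕ.* ℤ.∣ h ∣                        ≡⟨ ℕ.*-comm N ℤ.∣ h ∣ ⟩
        ℤ.∣ h ∣ ℕ.* N                        ∎)
    }
    where
    swap : ∀ r n f → r * (n * f) ≡ n * (r * f)
    swap = solve 3 (λ r n f → r :* (n :* f) := n :* (r :* f)) refl
      where open +-*-Solver

{-# OPTIONS --safe #-}
-- Multiplying ∑ₖ |k F ∩ M| tᵏ by 1 - t removes the translate by (vᵢ , 1) of the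
-- cone over F, and so restricts the i-th coefficient from [0 , ∞) to [0 , 1);
-- hence h*(F , t) counts the lattice points of a half-open parallelepiped.
-- Splitting [0 , 1) into {0} and (0 , 1) at every vertex, the alternating sum
-- over the faces leaves the points of the open parallelepiped.  Its points are
-- the words of the code without zero entries, scaled by 1 / N.
module Submission where

open import Defs
open import Data.Nat using (ℕ)
open import Function using (_⇔_)

open import Data.Nat as ℕ using (zero; suc; NonZero)
import Data.Nat.Properties as ℕ
open import Data.Nat.Divisibility using (_∣_; divides)
open import Data.Integer as ℤ using (ℤ; +_; -[1+_]; 0ℤ; -1ℤ)
import Data.Integer.Properties as ℤ
open import Data.Integer.Solver using () renaming (module +-*-Solver to ℤ-Solver)
open import Data.Rational using (ℚ; mkℚ; _+_; _*_; _≤_; _<_; 0ℚ; 1ℚ; ↥_; ↧_; ↧ₙ_; *<*; *≤*; toℚᵘ; positive)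
import Data.Rational as ℚ
import Data.Rational.Properties as ℚ
open import Data.Rational.Solver using (module +-*-Solver)
open import Data.Rational.Unnormalised as ℚᵘ using (mkℚᵘ; *≡*)
import Data.Rational.Unnormalised.Properties as ℚᵘ
open import Data.Fin using (Fin; zero; suc; toℕ; fromℕ<; punchIn)
import Data.Fin.Properties as Fin
open import Data.Fin.Subset using (Subset; inside; outside) renaming (∣_∣ to size)
open import Data.Fin.Subset.Properties using (∣p∣≤n)
open import Data.Vec as Vec using (Vec; []; _∷_; lookup; replicate; zipWith; _[_]≔_; _[_]=_)
import Data.Vec.Properties as Vec
open import Data.Vec.Functional using (updateAt)
import Data.Vec.Functional.Properties as VF
open import Data.List as List using (List; []; _∷_; _++_; map; filter; foldr; length)
import Data.List.Properties as List
open import Data.List.Membership.Propositional using (_∈_)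
open import Data.List.Membership.Propositional.Properties using (∈-filter⁺; ∈-filter⁻; ∈-map⁺; ∈-map⁻)
open import Data.List.Membership.Propositional.Properties.WithK using (unique∧set⇒bag)
open import Data.List.Relation.Binary.BagAndSetEquality using (∼bag⇒↭)
open import Data.List.Relation.Binary.Permutation.Propositional.Properties using (↭-length)
open import Data.List.Relation.Unary.Any using (here)
open import Data.List.Relation.Unary.Unique.Propositional using (Unique)
import Data.List.Relation.Unary.Unique.Propositional.Properties as Unique
open import Algebra.Properties.CommutativeMonoid.Sum ℚ.+-0-commutativeMonoid using (sum; sum-cong-≗; sum-remove)
open import Data.Product using (∃-syntax; _×_; _,_; proj₁; proj₂)
open import Data.Sum using (_⊎_; inj₁; inj₂)
open import Function using (_∘_; mk⇔; Equivalence)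
open import Level using (0ℓ)
open import Relation.Nullary using (¬_; yes; no; contradiction; _×-dec_)
open import Relation.Unary using (Pred; Decidable)
open import Relation.Binary.PropositionalEquality using (_≡_; _≢_; _≗_; refl; sym; trans; cong; cong₂; subst; module ≡-Reasoning)

-- Lengths of lists without repetitions and of filtered lists.

module _ {A : Set} where

  -- Without repetitions, equality as sets upgrades to equality as bags, hence to a permutation,
  -- which preserves length.
  length-unique : ∀ {xs ys : List A} → Unique xs → Unique ys → (∀ {x} → x ∈ xs ⇔ x ∈ ys) → length xs ≡ length ys
  length-unique xs! ys! xs⇔ys = ↭-length (∼bag⇒↭ (unique∧set⇒bag xs! ys! xs⇔ys))

  length-empty : ∀ (xs : List A) → (∀ x → ¬ x ∈ xs) → length xs ≡ 0
  length-empty []      _ = refl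
  length-empty (x ∷ _) f = contradiction (here refl) (f x)

  length≡0⇒∉ : ∀ (xs : List A) {x} → length xs ≡ 0 → ¬ x ∈ xs
  length≡0⇒∉ [] _ ()

  length-filter-⊎ : ∀ {P Q R : Pred A 0ℓ} (P? : Decidable P) (Q? : Decidable Q) (R? : Decidable R) →
    (∀ {x} → P x → Q x ⊎ R x) → (∀ {x} → Q x → P x) → (∀ {x} → R x → P x) → (∀ {x} → Q x → ¬ R x) →
    ∀ xs → length (filter P? xs) ≡ length (filter Q? xs) ℕ.+ length (filter R? xs)
  length-filter-⊎ P? Q? R? split Q⇒P R⇒P disjoint = go
    where
    go : ∀ xs → length (filter P? xs) ≡ length (filter Q? xs) ℕ.+ length (filter R? xs)
    go []       = refl
    go (x ∷ xs) with P? x | Q? x | R? x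
    ... | _      | yes q | yes r = contradiction r (disjoint q)
    ... | yes _  | yes _ | no _  = cong suc (go xs)
    ... | yes _  | no _  | yes _ = trans (cong suc (go xs)) (sym (ℕ.+-suc _ _))
    ... | no _   | no _  | no _  = go xs
    ... | no ¬p  | yes q | no _  = contradiction (Q⇒P q) ¬p
    ... | no ¬p  | no _  | yes r = contradiction (R⇒P r) ¬p
    ... | yes p  | no ¬q | no ¬r with split p
    ...   | inj₁ q = contradiction q ¬q
    ...   | inj₂ r = contradiction r ¬r

-- Ranges for the coefficients of a lattice point.

data Range : Set where
  [0,0] [0,∞[ [0,1[ ]0,1[ [1,∞[ : Range

-- Ranges are codes interpreted here, so that a condition on a whole coefficient vector is a `Vec`
-- of codes, updated at one position at a time and decided entry by entry.
Holds : Range → Pred ℚ 0ℓ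
Holds [0,0] q = q ≡ 0ℚ
Holds [0,∞[ q = 0ℚ ≤ q
Holds [0,1[ q = 0ℚ ≤ q × q < 1ℚ
Holds ]0,1[ q = 0ℚ < q × q < 1ℚ
Holds [1,∞[ q = 1ℚ ≤ q

holds? : ∀ r → Decidable (Holds r)
holds? [0,0] q = q ℚ.≟ 0ℚ
holds? [0,∞[ q = 0ℚ ℚ.≤? q
holds? [0,1[ q = (0ℚ ℚ.≤? q) ×-dec (q ℚ.<? 1ℚ)
holds? ]0,1[ q = (0ℚ ℚ.<? q) ×-dec (q ℚ.<? 1ℚ)
holds? [1,∞[ q = 1ℚ ℚ.≤? q

0≤1 : 0ℚ ≤ 1ℚ
0≤1 = *≤* (ℤ.+≤+ ℕ.z≤n)

holds⇒0≤ : ∀ r {q} → Holds r q → 0ℚ ≤ q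
holds⇒0≤ [0,0] e         = ℚ.≤-reflexive (sym e)
holds⇒0≤ [0,∞[ 0≤q       = 0≤q
holds⇒0≤ [0,1[ (0≤q , _) = 0≤q
holds⇒0≤ ]0,1[ (0<q , _) = ℚ.<⇒≤ 0<q
holds⇒0≤ [1,∞[ 1≤q       = ℚ.≤-trans 0≤1 1≤q

-- Two instances are used: splitting `[0,∞[` at 1 explains one factor 1 - t, and splitting `[0,1[`
-- at 0 explains the cancellation in the alternating sum.
record Split (x y z : Range) : Set where
  field
    cover    : ∀ {q} → Holds x q → Holds y q ⊎ Holds z q
    left     : ∀ {q} → Holds y q → Holds x q
    right    : ∀ {q} → Holds z q → Holds x q
    disjoint : ∀ {q} → Holds y q → ¬ Holds z q

split-at-1 : Split [0,∞[ [0,1[ [1,∞[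
split-at-1 = record
  { cover    = cover
  ; left     = proj₁
  ; right    = ℚ.≤-trans 0≤1
  ; disjoint = λ (_ , q<1) 1≤q → ℚ.<-irrefl refl (ℚ.<-≤-trans q<1 1≤q)
  }
  where
  cover : ∀ {q} → Holds [0,∞[ q → Holds [0,1[ q ⊎ Holds [1,∞[ q
  cover {q} 0≤q with q ℚ.<? 1ℚ
  ... | yes q<1 = inj₁ (0≤q , q<1)
  ... | no q≮1  = inj₂ (ℚ.≮⇒≥ q≮1)

split-at-0 : Split [0,1[ [0,0] ]0,1[
split-at-0 = record
  { cover    = cover
  ; left     = λ { refl → ℚ.≤-refl , *<* (ℤ.+<+ (ℕ.s≤s ℕ.z≤n)) }
  ; right    = λ (0<q , q<1) → ℚ.<⇒≤ 0<q , q<1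
  ; disjoint = λ e (0<q , _) → ℚ.<-irrefl (sym e) 0<q
  }
  where
  cover : ∀ {q} → Holds [0,1[ q → Holds [0,0] q ⊎ Holds ]0,1[ q
  cover {q} (0≤q , q<1) with 0ℚ ℚ.<? q
  ... | yes 0<q = inj₂ (0<q , q<1)
  ... | no 0≮q  = inj₁ (ℚ.≤-antisym (ℚ.≮⇒≥ 0≮q) 0≤q)

Sat : ∀ {n} → Vec Range n → Pred (Fin n → ℚ) 0ℓ
Sat c a = ∀ i → Holds (lookup c i) (a i)

sat? : ∀ {n} (c : Vec Range n) → Decidable (Sat c)
sat? c a = Fin.all? (λ i → holds? (lookup c i) (a i))

sat-at : ∀ {n} (c : Vec Range n) i {x a} → Sat (c [ i ]≔ x) a → Holds x (a i)
sat-at c i {x} {a} s = subst (λ r → Holds r (a i)) (Vec.lookup∘update i c x) (s i)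

-- The range and the coefficient at `i` may change together, which is what translation by a vertex
-- needs. Updating `c` on both sides makes its own entry at `i` irrelevant.
sat-update : ∀ {n} (c : Vec Range n) i {x y a b} → Holds y (b i) → (∀ j → j ≢ i → a j ≡ b j) →
  Sat (c [ i ]≔ x) a → Sat (c [ i ]≔ y) b
sat-update c i {x} {y} {a} {b} y∋bi a≗b s j with j Fin.≟ i
... | yes refl = subst (λ r → Holds r (b i)) (sym (Vec.lookup∘update i c y)) y∋bi
... | no j≢i   = subst (λ r → Holds r (b j)) (trans (Vec.lookup∘update′ j≢i c x) (sym (Vec.lookup∘update′ j≢i c y)))
  (subst (Holds (lookup (c [ i ]≔ x) j)) (a≗b j j≢i) (s j))

sat-change : ∀ {n} (c : Vec Range n) i {x y a} → (Holds x (a i) → Holds y (a i)) →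
  Sat (c [ i ]≔ x) a → Sat (c [ i ]≔ y) a
sat-change c i {x} {y} {a} x⊆y s = sat-update c i {x} {y} (x⊆y (sat-at c i s)) (λ _ _ → refl) s

cone halfOpenBox : ∀ {n} → Subset n → Vec Range n
cone = Vec.map λ { inside → [0,∞[ ; outside → [0,0] }
halfOpenBox = Vec.map λ { inside → [0,1[ ; outside → [0,0] }

-- Powers of 1 - t applied to counting series of cones.

times[1-t]^-cong : ∀ n {f g} → f ≗ g → times[1-t]^ n f ≗ times[1-t]^ n g
times[1-t]^-cong zero    f≗g k       = f≗g k
times[1-t]^-cong (suc n) f≗g zero    = times[1-t]^-cong n f≗g zero
times[1-t]^-cong (suc n) f≗g (suc k) = cong₂ ℤ._-_ (times[1-t]^-cong n f≗g (suc k)) (times[1-t]^-cong n f≗g k)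

-- The case split on the index is needed because `times[1-t]^ (suc n)` computes only once the index
-- is a constructor.
times[1-t]^-suc : ∀ n f → times[1-t]^ (suc n) f ≗ times[1-t]^ 1 (times[1-t]^ n f)
times[1-t]^-suc n f zero    = refl
times[1-t]^-suc n f (suc k) = refl

-- Each vertex of `S` uses up one factor 1 - t. Since `g` is arbitrary, the induction can fix the
-- range at the first vertex, treat the remaining ones, and spend the last factor on the first.
times-cone : ∀ {n} (g : Vec Range n → Series) →
  (∀ c i → times[1-t]^ 1 (g (c [ i ]≔ [0,∞[)) ≗ g (c [ i ]≔ [0,1[)) →
  ∀ S → times[1-t]^ (size S) (g (cone S)) ≗ g (halfOpenBox S)
times-cone g step []            k = refl
times-cone g step (outside ∷ S) k = times-cone (g ∘ ([0,0] ∷_)) (λ c i → step ([0,0] ∷ c) (suc i)) S k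
times-cone g step (inside ∷ S)  k = begin
  times[1-t]^ (suc (size S)) (g ([0,∞[ ∷ cone S)) k
    ≡⟨ times[1-t]^-suc (size S) (g ([0,∞[ ∷ cone S)) k ⟩
  times[1-t]^ 1 (times[1-t]^ (size S) (g ([0,∞[ ∷ cone S))) k
    ≡⟨ times[1-t]^-cong 1 (times-cone (g ∘ ([0,∞[ ∷_)) (λ c i → step ([0,∞[ ∷ c) (suc i)) S) k ⟩
  times[1-t]^ 1 (g ([0,∞[ ∷ halfOpenBox S)) k
    -- The leading `[0,0]` is a placeholder, overwritten by the update at position `zero`.
    ≡⟨ step ([0,0] ∷ halfOpenBox S) zero k ⟩
  g ([0,1[ ∷ halfOpenBox S) k ∎
  where open ≡-Reasoning

-- Alternating sums over faces.

sumℤ : List ℤ → ℤ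
sumℤ = foldr ℤ._+_ 0ℤ

sumℤ-++ : ∀ xs ys → sumℤ (xs ++ ys) ≡ sumℤ xs ℤ.+ sumℤ ys
sumℤ-++ []       ys = sym (ℤ.+-identityˡ (sumℤ ys))
sumℤ-++ (x ∷ xs) ys = trans (cong (λ z → x ℤ.+ z) (sumℤ-++ xs ys)) (sym (ℤ.+-assoc x (sumℤ xs) (sumℤ ys)))

sumℤ-neg : ∀ {A : Set} (f : A → ℤ) xs → sumℤ (map (ℤ.-_ ∘ f) xs) ≡ ℤ.- sumℤ (map f xs)
sumℤ-neg f []       = refl
sumℤ-neg f (x ∷ xs) = trans (cong (λ z → ℤ.- f x ℤ.+ z) (sumℤ-neg f xs)) (sym (ℤ.neg-distrib-+ (f x) (sumℤ (map f xs))))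

-- Pair each face avoiding the first vertex with the face that adjoins it. Their signs are opposite,
-- so at that vertex `[0,1[` minus `[0,0]` remains, which is `]0,1[` by `split`; the other vertices
-- follow by induction.
alternating-sum : ∀ {n} (g : Vec Range n → ℤ) →
  (∀ c i → g (c [ i ]≔ [0,1[) ≡ g (c [ i ]≔ [0,0]) ℤ.+ g (c [ i ]≔ ]0,1[)) →
  sumℤ (map (λ S → (-1ℤ ℤ.^ (n ℕ.∸ size S)) ℤ.* g (halfOpenBox S)) (subsets n)) ≡ g (replicate n ]0,1[)
alternating-sum {zero}  g split = trans (ℤ.+-identityʳ _) (ℤ.*-identityˡ (g []))
alternating-sum {suc n} g split = begin
  sumℤ (map term (map (outside ∷_) Ss ++ map (inside ∷_) Ss))
    ≡⟨ cong sumℤ (List.map-++ term (map (outside ∷_) Ss) (map (inside ∷_) Ss)) ⟩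
  sumℤ (map term (map (outside ∷_) Ss) ++ map term (map (inside ∷_) Ss))
    ≡⟨ sumℤ-++ (map term (map (outside ∷_) Ss)) (map term (map (inside ∷_) Ss)) ⟩
  sumℤ (map term (map (outside ∷_) Ss)) ℤ.+ sumℤ (map term (map (inside ∷_) Ss))
    ≡⟨ cong₂ (λ xs ys → sumℤ xs ℤ.+ sumℤ ys) (sym (List.map-∘ Ss)) (sym (List.map-∘ Ss)) ⟩
  sumℤ (map (term ∘ (outside ∷_)) Ss) ℤ.+ sumℤ (map (term ∘ (inside ∷_)) Ss)
    -- Only the outside half needs rewriting: on the inside half the exponent `suc n ∸ suc (size S)`
    -- already computes to `n ∸ size S`.
    ≡⟨ cong (λ xs → sumℤ xs ℤ.+ sumℤ (map (term ∘ (inside ∷_)) Ss)) (List.map-cong term-outside Ss) ⟩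
  sumℤ (map (ℤ.-_ ∘ facet [0,0]) Ss) ℤ.+ sumℤ (map (facet [0,1[) Ss)
    ≡⟨ cong₂ ℤ._+_ (trans (sumℤ-neg (facet [0,0]) Ss) (cong ℤ.-_ (ih [0,0]))) (ih [0,1[) ⟩
  ℤ.- g ([0,0] ∷ o) ℤ.+ g ([0,1[ ∷ o)
    ≡⟨ cong (λ z → ℤ.- g ([0,0] ∷ o) ℤ.+ z) (split ([0,0] ∷ o) zero) ⟩
  ℤ.- g ([0,0] ∷ o) ℤ.+ (g ([0,0] ∷ o) ℤ.+ g (]0,1[ ∷ o))
    ≡⟨ solve 2 (λ x y → :- x :+ (x :+ y) := y) refl (g ([0,0] ∷ o)) (g (]0,1[ ∷ o)) ⟩
  g (]0,1[ ∷ o) ∎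
  where
  open ≡-Reasoning
  open ℤ-Solver
  Ss = subsets n
  o = replicate n ]0,1[
  term : Subset (suc n) → ℤ
  term S = (-1ℤ ℤ.^ (suc n ℕ.∸ size S)) ℤ.* g (halfOpenBox S)
  facet : Range → Subset n → ℤ
  facet r S = (-1ℤ ℤ.^ (n ℕ.∸ size S)) ℤ.* g (r ∷ halfOpenBox S)
  term-outside : term ∘ (outside ∷_) ≗ ℤ.-_ ∘ facet [0,0]
  term-outside S = begin
    -- The bound `size S ≤ n` keeps the truncated subtraction exact, so one factor -1 can be taken
    -- out.
    (-1ℤ ℤ.^ (suc n ℕ.∸ size S)) ℤ.* y          ≡⟨ cong (λ e → (-1ℤ ℤ.^ e) ℤ.* y) (ℕ.+-∸-assoc 1 (∣p∣≤n S)) ⟩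
    -1ℤ ℤ.* (-1ℤ ℤ.^ (n ℕ.∸ size S)) ℤ.* y      ≡⟨ solve 2 (λ x y → con -1ℤ :* x :* y := :- (x :* y)) refl (-1ℤ ℤ.^ (n ℕ.∸ size S)) y ⟩
    ℤ.- ((-1ℤ ℤ.^ (n ℕ.∸ size S)) ℤ.* y)        ∎
    where y = g ([0,0] ∷ halfOpenBox S)
  ih : ∀ r → sumℤ (map (facet r) Ss) ≡ g (r ∷ o)
  ih r = alternating-sum (g ∘ (r ∷_)) (λ c i → split (r ∷ c) (suc i))

-- Translation by the vectors `(vᵢ , 1)`.

sum-increase : ∀ {n} {f g : Fin n → ℚ} i {y} → f i ≡ g i + y → (∀ j → j ≢ i → f j ≡ g j) → sum f ≡ sum g + y
sum-increase {suc n} {f} {g} i {y} fi f≗g = begin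
  sum f                                  ≡⟨ sum-remove {i = i} f ⟩
  f i + sum (f ∘ punchIn i)              ≡⟨ cong₂ _+_ fi (sum-cong-≗ (λ j → f≗g (punchIn i j) (Fin.punchInᵢ≢i i j))) ⟩
  g i + y + sum (g ∘ punchIn i)          ≡⟨ solve 3 (λ x y s → x :+ y :+ s := x :+ s :+ y) refl (g i) y (sum (g ∘ punchIn i)) ⟩
  g i + sum (g ∘ punchIn i) + y          ≡⟨ cong (_+ y) (sym (sum-remove {i = i} g)) ⟩
  sum g + y                              ∎
  where
  open ≡-Reasoning
  open +-*-Solver

infixl 6 _⊕_ _⊖_

_⊕_ _⊖_ : ∀ {d} → Lattice d → Lattice d → Lattice d
_⊕_ = zipWith ℤ._+_
_⊖_ = zipWith ℤ._-_

⊖-⊕ : ∀ {d} (m w : Lattice d) → (m ⊖ w) ⊕ w ≡ m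
⊖-⊕ []      []      = refl
⊖-⊕ (x ∷ m) (y ∷ w) = cong₂ _∷_ (solve 2 (λ x y → x :- y :+ y := x) refl x y) (⊖-⊕ m w)
  where open ℤ-Solver

⊕-⊖ : ∀ {d} (m w : Lattice d) → (m ⊕ w) ⊖ w ≡ m
⊕-⊖ []      []      = refl
⊕-⊖ (x ∷ m) (y ∷ w) = cong₂ _∷_ (solve 2 (λ x y → x :+ y :- y := x) refl x y) (⊕-⊖ m w)
  where open ℤ-Solver

-- This is the geometric side of multiplication by t: the height grows by one, and in terms of
-- coefficients only the entry at `i` moves.
translate : ∀ {d n} (v : Fin n → Lattice d) a {m h} i → Combination v a (m , h) →
  Combination v (updateAt a i (_+ 1ℚ)) (m ⊕ v i , h ℤ.+ + 1)
translate {d} {n} v a {m} {h} i (am , ah) = vectors , heights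
  where
  open ≡-Reasoning
  b = updateAt a i (_+ 1ℚ)
  bi : b i ≡ a i + 1ℚ
  bi = VF.updateAt-updates i a
  b≗a : ∀ j → j ≢ i → b j ≡ a j
  b≗a j j≢i = VF.updateAt-minimal j i a j≢i
  heights : sum b ≡ toℚ (h ℤ.+ + 1)
  heights = trans (sum-increase i bi b≗a) (trans (cong (_+ 1ℚ) ah) (sym (toℚ-+ h (+ 1))))
  vectors : ∀ j → sum (λ l → b l * toℚ (lookup (v l) j)) ≡ toℚ (lookup (m ⊕ v i) j)
  vectors j = begin
    sum (λ l → b l * x l)             ≡⟨ sum-increase i (trans (cong (_* x i) bi) (distrib (a i) (x i))) (λ l l≢i → cong (_* x l) (b≗a l l≢i)) ⟩
    sum (λ l → a l * x l) + x i       ≡⟨ cong (_+ x i) (am j) ⟩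
    toℚ (lookup m j) + x i            ≡⟨ sym (toℚ-+ (lookup m j) (lookup (v i) j)) ⟩
    toℚ (lookup m j ℤ.+ lookup (v i) j) ≡⟨ cong toℚ (sym (Vec.lookup-zipWith ℤ._+_ j m (v i))) ⟩
    toℚ (lookup (m ⊕ v i) j)          ∎
    where
    open +-*-Solver
    x : Fin n → ℚ
    x l = toℚ (lookup (v l) j)
    distrib : ∀ a x → (a + 1ℚ) * x ≡ a * x + x
    distrib = solve 2 (λ a x → (a :+ con 1ℚ) :* x := a :* x :+ x) refl

-- Counting lattice points by their coefficients.

module _ {d} (Δ : Simplex d) where

  private
    v = vertex Δ

  coords : ℕ → Lattice d → Fin (suc d) → ℚ
  coords k m = proj₁ (coordinates Δ (m , + k))

  coords-combination : ∀ k m → Combination v (coords k m) (m , + k)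
  coords-combination k m = proj₂ (coordinates Δ (m , + k))

  coords-unique : ∀ k m {a} → Combination v a (m , + k) → a ≗ coords k m
  coords-unique k m {a} comb = coordinates-unique Δ {a} {coords k m} {p = m , + k} comb (coords-combination k m)

  -- Every range consists of nonnegative numbers, so the enumeration of the dilate of all of `Δ`
  -- contains every point in question. Filtering one common list for all `c` reduces additivity of
  -- the counts to a fact about filters.
  points : Vec Range (suc d) → ℕ → List (Lattice d)
  points c k = filter (λ m → sat? c (coords k m)) (Enumeration.elements (facePoints Δ (replicate _ inside) k))

  points-unique : ∀ c k → Unique (points c k)
  points-unique c k = Unique.filter⁺ (λ m → sat? c (coords k m)) (Enumeration.unique (facePoints Δ (replicate _ inside) k))

  points⁻ : ∀ c k {m} → m ∈ points c k → Sat c (coords k m)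
  points⁻ c k m∈ = proj₂ (∈-filter⁻ (λ m → sat? c (coords k m)) {xs = Enumeration.elements (facePoints Δ (replicate _ inside) k)} m∈)

  points⁺ : ∀ c k {m} → Sat c (coords k m) → m ∈ points c k
  points⁺ c k {m} s = ∈-filter⁺ (λ m → sat? c (coords k m))
    (Equivalence.from (Enumeration.exact (facePoints Δ (replicate _ inside) k) m)
      (coords k m , (λ i → holds⇒0≤ (lookup c i) (s i)) ,
       (λ i i∉ → contradiction (Vec.lookup⇒[]= i _ (Vec.lookup-replicate i inside)) i∉) ,
       coords-combination k m))
    s

  count : Vec Range (suc d) → ℕ → ℕ
  count c k = length (points c k)

  count-split : ∀ {x y z} → Split x y z → ∀ c i k → count (c [ i ]≔ x) k ≡ count (c [ i ]≔ y) k ℕ.+ count (c [ i ]≔ z) k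
  count-split {x} {y} {z} x=y⊎z c i k = length-filter-⊎
    (λ m → sat? (c [ i ]≔ x) (coords k m)) (λ m → sat? (c [ i ]≔ y) (coords k m)) (λ m → sat? (c [ i ]≔ z) (coords k m))
    cover′ (sat-change c i {y} {x} left) (sat-change c i {z} {x} right)
    (λ sy sz → disjoint (sat-at c i sy) (sat-at c i sz))
    (Enumeration.elements (facePoints Δ (replicate _ inside) k))
    where
    open Split x=y⊎z
    cover′ : ∀ {m} → Sat (c [ i ]≔ x) (coords k m) → Sat (c [ i ]≔ y) (coords k m) ⊎ Sat (c [ i ]≔ z) (coords k m)
    cover′ s with cover (sat-at c i s)
    ... | inj₁ h = inj₁ (sat-change c i {x} {y} (λ _ → h) s)
    ... | inj₂ h = inj₂ (sat-change c i {x} {z} (λ _ → h) s)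

  -- At height 0 the coefficients are nonnegative with sum 0, so none can reach 1.
  count-large-zero : ∀ c i → count (c [ i ]≔ [1,∞[) 0 ≡ 0
  count-large-zero c i = length-empty (points c′ 0) λ m m∈ →
    let s = points⁻ c′ 0 m∈ in
    ℚ.<-irrefl refl (ℚ.<-≤-trans (*<* (ℤ.+<+ (ℕ.s≤s ℕ.z≤n))) (ℚ.≤-trans (sat-at c i s)
      (subst (coords 0 m i ≤_) (proj₂ (coords-combination 0 m))
        (term≤sum (coords 0 m) (λ j → holds⇒0≤ (lookup c′ j) (s j)) i))))
    where c′ = c [ i ]≔ [1,∞[

  -- Both sides are coefficients of the same point, so affine independence identifies them.
  coords-translate : ∀ k m i → coords (suc k) (m ⊕ v i) ≗ updateAt (coords k m) i (_+ 1ℚ)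
  coords-translate k m i j = sym (coords-unique (suc k) (m ⊕ v i) {updateAt (coords k m) i (_+ 1ℚ)}
    (subst (λ h → Combination v (updateAt (coords k m) i (_+ 1ℚ)) (m ⊕ v i , h)) (cong +_ (ℕ.+-comm k 1))
      (translate v (coords k m) {m} {+ k} i (coords-combination k m))) j)

  coords-translate-at : ∀ k m i → coords (suc k) (m ⊕ v i) i ≡ coords k m i + 1ℚ
  coords-translate-at k m i = trans (coords-translate k m i i) (VF.updateAt-updates i (coords k m))

  coords-translate-off : ∀ k m i j → j ≢ i → coords k m j ≡ coords (suc k) (m ⊕ v i) j
  coords-translate-off k m i j j≢i = sym (trans (coords-translate k m i j) (VF.updateAt-minimal j i (coords k m) j≢i))

  -- Translation by `(vᵢ , 1)` is a bijection between the two sets of points; its inverse subtracts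
  -- `v i`.
  count-large-suc : ∀ c i k → count (c [ i ]≔ [1,∞[) (suc k) ≡ count (c [ i ]≔ [0,∞[) k
  count-large-suc c i k = trans
    (length-unique (points-unique c₁ (suc k)) (Unique.map⁺ injective (points-unique c₀ k)) (mk⇔ to from))
    (List.length-map (_⊕ v i) (points c₀ k))
    where
    c₀ = c [ i ]≔ [0,∞[
    c₁ = c [ i ]≔ [1,∞[
    injective : ∀ {m m′} → m ⊕ v i ≡ m′ ⊕ v i → m ≡ m′
    injective {m} {m′} e = trans (sym (⊕-⊖ m (v i))) (trans (cong (_⊖ v i) e) (⊕-⊖ m′ (v i)))
    from : ∀ {m} → m ∈ map (_⊕ v i) (points c₀ k) → m ∈ points c₁ (suc k)
    from m∈ with ∈-map⁻ (_⊕ v i) m∈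
    ... | m , m∈₀ , refl = points⁺ c₁ (suc k) (sat-update c i {[0,∞[} {[1,∞[} {coords k m}
      (subst (1ℚ ≤_) (sym (coords-translate-at k m i))
        (subst (_≤ coords k m i + 1ℚ) (ℚ.+-identityˡ 1ℚ) (ℚ.+-monoˡ-≤ 1ℚ (sat-at c i (points⁻ c₀ k m∈₀)))))
      (coords-translate-off k m i) (points⁻ c₀ k m∈₀))
    -- The point is first taken in the form `m ⊕ v i`, to which the formulas for translated
    -- coordinates apply; `to` then substitutes `m ⊖ v i` for `m`.
    to′ : ∀ m → m ⊕ v i ∈ points c₁ (suc k) → m ⊕ v i ∈ map (_⊕ v i) (points c₀ k)
    to′ m m∈ = ∈-map⁺ (_⊕ v i) (points⁺ c₀ k (sat-update c i {[1,∞[} {[0,∞[} {coords (suc k) (m ⊕ v i)}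
      (ℚ.≮⇒≥ λ neg → ℚ.<-irrefl refl (ℚ.<-≤-trans
        (subst (coords k m i + 1ℚ <_) (ℚ.+-identityˡ 1ℚ) (ℚ.+-monoˡ-< 1ℚ neg))
        (subst (1ℚ ≤_) (coords-translate-at k m i) (sat-at c i (points⁻ c₁ (suc k) m∈)))))
      (λ j j≢i → sym (coords-translate-off k m i j j≢i)) (points⁻ c₁ (suc k) m∈)))
    to : ∀ {m} → m ∈ points c₁ (suc k) → m ∈ map (_⊕ v i) (points c₀ k)
    to {m} m∈ = subst (_∈ map (_⊕ v i) (points c₀ k)) (⊖-⊕ m (v i))
      (to′ (m ⊖ v i) (subst (_∈ points c₁ (suc k)) (sym (⊖-⊕ m (v i))) m∈))

  countℤ : Vec Range (suc d) → Series
  countℤ c k = + count c k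

  -- The points with i-th coefficient at least 1 have t times the series of `[0,∞[`. Subtracting it
  -- leaves those with coefficient in `[0,1[`. The constant term is separate, as nothing is shifted
  -- into height 0.
  countℤ-difference : ∀ c i → times[1-t]^ 1 (countℤ (c [ i ]≔ [0,∞[)) ≗ countℤ (c [ i ]≔ [0,1[)
  countℤ-difference c i zero    = cong +_ (trans (count-split split-at-1 c i 0)
    (trans (cong (λ n → count (c [ i ]≔ [0,1[) 0 ℕ.+ n) (count-large-zero c i)) (ℕ.+-identityʳ _)))
  countℤ-difference c i (suc k) = begin
    + count c₀ (suc k) ℤ.- + count c₀ k                      ≡⟨ cong (λ n → + n ℤ.- + count c₀ k) (count-split split-at-1 c i (suc k)) ⟩
    + (b ℕ.+ count (c [ i ]≔ [1,∞[) (suc k)) ℤ.- + count c₀ k ≡⟨ cong (λ n → + (b ℕ.+ n) ℤ.- + count c₀ k) (count-large-suc c i k) ⟩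
    + b ℤ.+ + count c₀ k ℤ.- + count c₀ k                    ≡⟨ solve 2 (λ x y → x :+ y :- y := x) refl (+ b) (+ count c₀ k) ⟩
    + b                                                      ∎
    where
    open ≡-Reasoning
    open ℤ-Solver
    c₀ = c [ i ]≔ [0,∞[
    b = count (c [ i ]≔ [0,1[) (suc k)

  -- Both lists enumerate the same set without repetition: by uniqueness, the coefficients
  -- witnessing membership in the dilated face are the chosen `coords`.
  ehrhart≡count : ∀ S k → ehrhart Δ S k ≡ count (cone S) k
  ehrhart≡count S k = length-unique (Enumeration.unique (facePoints Δ S k)) (points-unique (cone S) k)
    (λ {m} → mk⇔
      (λ m∈ → points⁺ (cone S) k (to m (Equivalence.to (Enumeration.exact (facePoints Δ S k) m) m∈)))
      (λ m∈ → Equivalence.from (Enumeration.exact (facePoints Δ S k) m) (from m (points⁻ (cone S) k m∈))))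
    where
    holds-cone : ∀ {n} (S : Subset n) i {q} → 0ℚ ≤ q → (¬ S [ i ]= inside → q ≡ 0ℚ) → Holds (lookup (cone S) i) q
    holds-cone (inside  ∷ S) zero    0≤q _  = 0≤q
    holds-cone (outside ∷ S) zero    _   e  = e λ ()
    holds-cone (_       ∷ S) (suc i) 0≤q e  = holds-cone S i 0≤q (λ i∉ → e λ { (Vec.there i∈) → i∉ i∈ })
    cone-support : ∀ {n} (S : Subset n) i {q} → Holds (lookup (cone S) i) q → ¬ S [ i ]= inside → q ≡ 0ℚ
    cone-support (inside  ∷ S) zero    _ i∉ = contradiction Vec.here i∉
    cone-support (outside ∷ S) zero    e _  = e
    cone-support (_       ∷ S) (suc i) h i∉ = cone-support S i h (i∉ ∘ Vec.there)
    to : ∀ m → InDilate Δ S k m → Sat (cone S) (coords k m)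
    to m (a , 0≤a , supp , comb) i =
      subst (Holds (lookup (cone S) i)) (coords-unique k m {a} comb i) (holds-cone S i (0≤a i) (supp i))
    from : ∀ m → Sat (cone S) (coords k m) → InDilate Δ S k m
    from m s = coords k m , (λ i → holds⇒0≤ (lookup (cone S) i) (s i)) ,
      (λ i → cone-support S i (s i)) , coords-combination k m

  hStar≡count : ∀ S → hStar Δ S ≗ countℤ (halfOpenBox S)
  hStar≡count S k = trans (times[1-t]^-cong (size S) (λ l → cong +_ (ehrhart≡count S l)) k)
    (times-cone countℤ countℤ-difference S k)

  localHStar≡count : localHStar Δ ≗ countℤ (replicate (suc d) ]0,1[)
  localHStar≡count j = trans
    (cong sumℤ (List.map-cong (λ S → cong ((-1ℤ ℤ.^ (suc d ℕ.∸ size S)) ℤ.*_) (hStar≡count S j)) (subsets (suc d))))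
    (alternating-sum (λ c → countℤ c j) (λ c i → trans (cong +_ (count-split split-at-0 c i j)) (ℤ.pos-+ (count (c [ i ]≔ [0,0]) j) (count (c [ i ]≔ ]0,1[) j))))

  -- Thinness and the open parallelepiped.

  OpenPoint : ℕ → Pred (Lattice d) 0ℓ
  OpenPoint k m = ∀ i → 0ℚ < coords k m i × coords k m i < 1ℚ

  -- Every coefficient of the local h*-polynomial is the number of open points at that height, so it
  -- vanishes exactly when there are none.
  thin⇔no-open-point : Thin Δ ⇔ (∀ k m → ¬ OpenPoint k m)
  thin⇔no-open-point = mk⇔ to from
    where
    o = replicate (suc d) ]0,1[
    to : Thin Δ → ∀ k m → ¬ OpenPoint k m
    to thin k m p = length≡0⇒∉ (points o k) (ℤ.+-injective (trans (sym (localHStar≡count k)) (thin k)))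
      (points⁺ o k (λ i → subst (λ r → Holds r (coords k m i)) (sym (Vec.lookup-replicate i ]0,1[)) (p i)))
    from : (∀ k m → ¬ OpenPoint k m) → Thin Δ
    from none k = trans (localHStar≡count k) (cong +_ (length-empty (points o k) (λ m m∈ → none k m
      (λ i → subst (λ r → Holds r (coords k m i)) (Vec.lookup-replicate i ]0,1[) (points⁻ o k m∈ i)))))

-- Clearing denominators.

toℚ-denominator-* : ∀ q → toℚ (↧ q) * q ≡ toℚ (↥ q)
toℚ-denominator-* q@(mkℚ n d-1 _) = ℚ.toℚᵘ-injective (begin
  toℚᵘ (toℚ (↧ q) * q)           ≈⟨ ℚ.toℚᵘ-homo-* (toℚ (↧ q)) q ⟩
  toℚᵘ (toℚ (↧ q)) ℚᵘ.* toℚᵘ q   ≈⟨ ℚᵘ.*-cong (ℚ.toℚᵘ-fromℚᵘ (mkℚᵘ (↧ q) 0)) ℚᵘ.≃-refl ⟩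
  mkℚᵘ (↧ q) 0 ℚᵘ.* toℚᵘ q       ≈⟨ *≡* (solve 2 (λ n d → d :* n :* con (+ 1) := n :* (con (+ 1) :* d)) refl n (↧ q)) ⟩
  mkℚᵘ n 0                       ≈⟨ ℚ.toℚᵘ-fromℚᵘ (mkℚᵘ n 0) ⟨
  toℚᵘ (toℚ n)                   ∎)
  where
  open ℚᵘ.≃-Reasoning
  open ℤ-Solver

toℚ-pos : ∀ N .{{_ : NonZero N}} → 0ℚ < toℚ (+ N)
toℚ-pos N = ℚ.≰⇒> λ N≤0 → ℕ.<⇒≱ (ℕ.>-nonZero⁻¹ N) (ℤ.drop‿+≤+ (toℚ-cancel-≤ {+ N} {+ 0} N≤0))

-- Write q = n / d and N = t d. Then N q = t n is a natural number, and q < 1 puts it below N.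
clear-denominator : ∀ {N} .{{_ : NonZero N}} q → ↧ₙ q ∣ N → 0ℚ ≤ q → q < 1ℚ →
  ∃[ c ] toℚ (+ toℕ {N} c) ≡ toℚ (+ N) * q
clear-denominator (mkℚ -[1+ _ ] _ _) _ (*≤* ()) _
clear-denominator {N} q@(mkℚ (+ n) _ _) (divides t N≡t*d) _ q<1 = fromℕ< tn<N , trans (cong (λ k → toℚ (+ k)) (Fin.toℕ-fromℕ< tn<N)) tn≡Nq
  where
  open ≡-Reasoning
  instance
    _ = positive (toℚ-pos N)
  tn≡Nq : toℚ (+ (t ℕ.* n)) ≡ toℚ (+ N) * q
  tn≡Nq = begin
    toℚ (+ (t ℕ.* n))              ≡⟨ trans (cong toℚ (ℤ.pos-* t n)) (toℚ-* (+ t) (+ n)) ⟩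
    toℚ (+ t) * toℚ (+ n)          ≡⟨ cong (toℚ (+ t) *_) (sym (toℚ-denominator-* q)) ⟩
    toℚ (+ t) * (toℚ (↧ q) * q)    ≡⟨ sym (ℚ.*-assoc (toℚ (+ t)) (toℚ (↧ q)) q) ⟩
    toℚ (+ t) * toℚ (↧ q) * q      ≡⟨ cong (_* q) (sym (trans (cong toℚ (ℤ.pos-* t (↧ₙ q))) (toℚ-* (+ t) (↧ q)))) ⟩
    toℚ (+ (t ℕ.* ↧ₙ q)) * q       ≡⟨ cong (λ k → toℚ (+ k) * q) (sym N≡t*d) ⟩
    toℚ (+ N) * q                  ∎
  tn<N : t ℕ.* n ℕ.< N
  tn<N = ℤ.drop‿+<+ (toℚ-cancel-< {+ (t ℕ.* n)} {+ N} (subst (_< toℚ (+ N)) (sym tn≡Nq)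
    (subst (toℚ (+ N) * q <_) (ℚ.*-identityʳ (toℚ (+ N))) (ℚ.*-monoʳ-<-pos (toℚ (+ N)) q<1))))

-- Open points and code words without zero entries.

module _ {d} (Δ : Simplex d) where

  private
    v = vertex Δ
    N = modulus Δ

  openPoint⇒word : ∀ {k m} → OpenPoint Δ k m → ∃[ c ] IsCodeWord Δ c × (∀ i → toℕ (c i) ≢ 0)
  openPoint⇒word {k} {m} p = (λ i → proj₁ (entry i)) , (a , inΛ , λ i → trans (proj₂ (entry i)) (cong (toℚ (+ N) *_) (sym (frac-a i)))) , nonzero
    where
    a = coords Δ k m
    frac-a : ∀ i → frac (a i) ≡ a i
    frac-a i = frac-id (ℚ.<⇒≤ (proj₁ (p i))) (proj₂ (p i))
    inΛ : Λ Δ a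
    inΛ = let am , ah = coords-combination Δ k m in
      (m , + k) ,
      (λ j → trans (sum-cong-≗ (λ i → cong (_* toℚ (lookup (v i) j)) (frac-a i))) (am j)) ,
      trans (sum-cong-≗ frac-a) ah
    entry : ∀ i → ∃[ c ] toℚ (+ toℕ {N} c) ≡ toℚ (+ N) * a i
    -- The coefficients equal their own fractional parts and so represent an element of `Λ Δ`; hence
    -- their denominators divide `N`.
    entry i = clear-denominator (a i)
      (IsLCM.commonMultiple (proj₂ (denominatorLCM Δ)) (a , inΛ , i , cong ↧ₙ_ (sym (frac-a i))))
      (ℚ.<⇒≤ (proj₁ (p i))) (proj₂ (p i))
    instance
      _ = positive (toℚ-pos N)
    nonzero : ∀ i → toℕ (proj₁ (entry i)) ≢ 0
    nonzero i e = ℚ.<-irrefl (trans (cong (λ n → toℚ (+ n)) (sym e)) (proj₂ (entry i)))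
      (subst (_< toℚ (+ N) * a i) (ℚ.*-zeroʳ (toℚ (+ N))) (ℚ.*-monoʳ-<-pos (toℚ (+ N)) (proj₁ (p i))))

  word⇒openPoint : ∀ {c} → IsCodeWord Δ c → (∀ i → toℕ (c i) ≢ 0) → ∃[ k ] ∃[ m ] OpenPoint Δ k m
  word⇒openPoint {c} (x , ((m , h) , comb) , e) nonzero =
    -- The height is a sum of fractional parts, hence nonnegative. So it is a natural number, as
    -- `OpenPoint` requires.
    open-point h comb (toℚ-cancel-≤ {+ 0} {h} (subst (0ℚ ≤_) (proj₂ comb) (0≤sum (frac ∘ x) (0≤frac ∘ x))))
    where
    0<frac : ∀ i → 0ℚ < frac (x i)
    -- A fractional part that is not positive is 0, which would make the i-th entry of the word 0.
    0<frac i = ℚ.≰⇒> λ frac≤0 → nonzero i (ℤ.+-injective (toℚ-injective {+ toℕ (c i)} {+ 0} (trans (e i)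
      (trans (cong (toℚ (+ N) *_) (ℚ.≤-antisym frac≤0 (0≤frac (x i)))) (ℚ.*-zeroʳ (toℚ (+ N)))))))
    open-point : ∀ h → Combination v (frac ∘ x) (m , h) → + 0 ℤ.≤ h → ∃[ k ] ∃[ m ] OpenPoint Δ k m
    open-point (+ k) comb _ = k , m , λ i →
      subst (λ q → 0ℚ < q × q < 1ℚ) (coords-unique Δ k m {frac ∘ x} comb i) (0<frac i , frac<1 (x i))

corollary2p7 : (d : ℕ) (Δ : Simplex d) → Thin Δ ⇔ ThinCode (code Δ)
corollary2p7 d Δ = mk⇔
  (λ thin (c , word , nonzero) → let k , m , p = word⇒openPoint Δ word nonzero in
    Equivalence.to (thin⇔no-open-point Δ) thin k m p)
  (λ thinCode → Equivalence.from (thin⇔no-open-point Δ) (λ k m p → thinCode (openPoint⇒word Δ p)))
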